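{- For every constant $c>0$ there exists a constant $C=C(c)>0$ such that the following holds. Let $G$ be a bipartite graph with $n$ vertices on each side and average degree $d\ge cn$. If $G$ is an $\alpha$-multitasker, where $\alpha\in(0,1]$, then $\alpha< C\,n^{ -1/2}$.
   Context: Graphs are finite and simple. A matching is a set of edges no two of which share a vertex. A matching $M'$ in $G$ is induced if no two distinct edges of $M'$ are joined by an edge of $G$. A bipartite graph $G$ with $n$ vertices on each side is an $\alpha$-multitasker if every matching $M$ in $G$ (of any size $k=1,\dots,n$) contains a matching $M'\subseteq M$ that is induced in $G$ with $|M'|\ge\alpha|M|$. -}

module Defs where

open import Data.Bool using (Bool; T)
open import Data.Empty using (⊥-elim)
open import Data.Fin using (Fin)
import Data.Integer as ℤ
import Data.Integer.Properties as ℤ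
open import Data.List using (List; allFin; cartesianProduct; filterᵇ; length; map; _++_)
open import Data.Nat as ℕ using (ℕ; zero; suc; NonZero)
import Data.Nat.Properties as ℕ
open import Data.Nat.ListAction using (sum)
open import Data.Nat.Tactic.RingSolver using (solve-∀)
open import Data.Product using (Σ-syntax; ∃-syntax; _×_; _,_; proj₁; proj₂)
open import Data.Rational as ℚ using (ℚ; 0ℚ; 1ℚ; ∣_∣; toℚᵘ)
import Data.Rational.Properties as ℚ
open import Data.Rational.Solver using (module +-*-Solver)
import Data.Rational.Unnormalised as ℚᵘ
import Data.Rational.Unnormalised.Properties as ℚᵘ
open import Data.Sum using (_⊎_; inj₁; inj₂)
open import Relation.Binary.PropositionalEquality
  using (_≡_; _≢_; refl; sym; trans; cong; cong₂; subst; subst₂)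
open import Relation.Nullary using (¬_; yes; no)

------------------------------------------------------------------------
-- Real numbers

-- Cauchy sequences of rationals. Equality of reals is never needed, so
-- the quotient is not formed; the orders below respect it.
record ℝ : Set where
  constructor mkℝ
  field
    seq    : ℕ → ℚ
    cauchy : ∀ ε → 0ℚ ℚ.< ε →
             ∃[ N ] (∀ m n → N ℕ.≤ m → N ℕ.≤ n → ∣ seq m ℚ.- seq n ∣ ℚ.≤ ε)
open ℝ public

infix 4 _<ℝ_ _≤ℝ_
infixl 7 _*ℝ_

_<ℝ_ : ℝ → ℝ → Set
x <ℝ y = ∃[ ε ] (0ℚ ℚ.< ε × ∃[ N ] (∀ n → N ℕ.≤ n → seq x n ℚ.+ ε ℚ.≤ seq y n))

_≤ℝ_ : ℝ → ℝ → Set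
x ≤ℝ y = ∀ ε → 0ℚ ℚ.< ε → ∃[ N ] (∀ n → N ℕ.≤ n → seq x n ℚ.≤ seq y n ℚ.+ ε)

fromℚ : ℚ → ℝ
fromℚ q = mkℝ (λ _ → q) λ ε 0<ε →
  0 , λ _ _ _ _ → subst (ℚ._≤ ε) (sym (cong ∣_∣ (ℚ.+-inverseʳ q))) (ℚ.<⇒≤ 0<ε)

fromℕ : ℕ → ℝ
fromℕ k = fromℚ (ℤ.+ k ℚ./ 1)

0ℝ 1ℝ : ℝ
0ℝ = fromℚ 0ℚ
1ℝ = fromℚ 1ℚ

private
  ∣p∣≤∣q∣+∣p-q∣ : ∀ p q → ∣ p ∣ ℚ.≤ ∣ q ∣ ℚ.+ ∣ p ℚ.- q ∣
  ∣p∣≤∣q∣+∣p-q∣ p q = subst (λ r → ∣ r ∣ ℚ.≤ ∣ q ∣ ℚ.+ ∣ p ℚ.- q ∣)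
    (solve 2 (λ a b → b :+ (a :- b) := a) refl p q) (ℚ.∣p+q∣≤∣p∣+∣q∣ q (p ℚ.- q))
    where open +-*-Solver

  eventual-bound : (x : ℝ) →
    ∃[ B ] (ℚ.Positive B × ∃[ N ] (∀ n → N ℕ.≤ n → ∣ seq x n ∣ ℚ.≤ B))
  eventual-bound x with cauchy x 1ℚ (ℚ.positive⁻¹ 1ℚ)
  ... | N , close = ∣ seq x N ∣ ℚ.+ 1ℚ
      , ℚ.nonNeg+pos⇒pos ∣ seq x N ∣ {{ℚ.∣-∣-nonNeg (seq x N)}} 1ℚ
      , N , λ n N≤n → ℚ.≤-trans (∣p∣≤∣q∣+∣p-q∣ (seq x n) (seq x N))
          (ℚ.+-monoʳ-≤ ∣ seq x N ∣ (close n N N≤n ℕ.≤-refl))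

  *-mono-∣∣ : ∀ p q a b → .{{ℚ.NonNegative a}} → ∣ p ∣ ℚ.≤ a → ∣ q ∣ ℚ.≤ b →
              ∣ p ℚ.* q ∣ ℚ.≤ a ℚ.* b
  *-mono-∣∣ p q a b p≤a q≤b = begin
    ∣ p ℚ.* q ∣      ≡⟨ ℚ.∣p*q∣≡∣p∣*∣q∣ p q ⟩
    ∣ p ∣ ℚ.* ∣ q ∣  ≤⟨ ℚ.*-monoʳ-≤-nonNeg ∣ q ∣ {{ℚ.∣-∣-nonNeg q}} p≤a ⟩
    a ℚ.* ∣ q ∣      ≤⟨ ℚ.*-monoˡ-≤-nonNeg a q≤b ⟩
    a ℚ.* b          ∎
    where open ℚ.≤-Reasoning

  product-difference : ∀ p q r s → p ℚ.* q ℚ.- r ℚ.* s ≡ p ℚ.* (q ℚ.- s) ℚ.+ s ℚ.* (p ℚ.- r)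
  product-difference = solve 4 (λ p q r s → p :* q :- r :* s := p :* (q :- s) :+ s :* (p :- r)) refl
    where open +-*-Solver

  product-close : ∀ p q r s A B δ → .{{ℚ.NonNegative A}} → .{{ℚ.NonNegative B}} →
    ∣ p ∣ ℚ.≤ A → ∣ s ∣ ℚ.≤ B → ∣ p ℚ.- r ∣ ℚ.≤ δ → ∣ q ℚ.- s ∣ ℚ.≤ δ →
    ∣ p ℚ.* q ℚ.- r ℚ.* s ∣ ℚ.≤ (A ℚ.+ B) ℚ.* δ
  product-close p q r s A B δ p≤A s≤B p~r q~s = begin
    ∣ p ℚ.* q ℚ.- r ℚ.* s ∣
      ≡⟨ cong ∣_∣ (product-difference p q r s) ⟩
    ∣ p ℚ.* (q ℚ.- s) ℚ.+ s ℚ.* (p ℚ.- r) ∣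
      ≤⟨ ℚ.∣p+q∣≤∣p∣+∣q∣ (p ℚ.* (q ℚ.- s)) (s ℚ.* (p ℚ.- r)) ⟩
    ∣ p ℚ.* (q ℚ.- s) ∣ ℚ.+ ∣ s ℚ.* (p ℚ.- r) ∣
      ≤⟨ ℚ.+-mono-≤ (*-mono-∣∣ p (q ℚ.- s) A δ p≤A q~s) (*-mono-∣∣ s (p ℚ.- r) B δ s≤B p~r) ⟩
    A ℚ.* δ ℚ.+ B ℚ.* δ
      ≡⟨ ℚ.*-distribʳ-+ δ A B ⟨
    (A ℚ.+ B) ℚ.* δ ∎
    where open ℚ.≤-Reasoning

  divide : ∀ K ε → ℚ.Positive K → 0ℚ ℚ.< ε → ∃[ δ ] (0ℚ ℚ.< δ × K ℚ.* δ ≡ ε)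
  divide K ε K>0 0<ε = ℚ.1/ K ℚ.* ε
    , ℚ.positive⁻¹ (ℚ.1/ K ℚ.* ε) {{ℚ.pos*pos⇒pos (ℚ.1/ K) {{ℚ.1/pos⇒pos K}} ε {{ℚ.positive 0<ε}}}}
    , trans (sym (ℚ.*-assoc K (ℚ.1/ K) ε))
        (trans (cong (ℚ._* ε) (ℚ.*-inverseʳ K)) (ℚ.*-identityˡ ε))
    where
    instance
      posK : ℚ.Positive K
      posK = K>0
      nonZeroK : ℚ.NonZero K
      nonZeroK = ℚ.pos⇒nonZero K

  product-cauchy : (x y : ℝ) → ∀ ε → 0ℚ ℚ.< ε → ∃[ N ] (∀ m n → N ℕ.≤ m → N ℕ.≤ n →
    ∣ seq x m ℚ.* seq y m ℚ.- seq x n ℚ.* seq y n ∣ ℚ.≤ ε)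
  product-cauchy x y ε 0<ε =
    let A , A>0 , N₁ , x≤A = eventual-bound x
        B , B>0 , N₂ , y≤B = eventual-bound y
        δ , 0<δ , eq = divide (A ℚ.+ B) ε (ℚ.pos+pos⇒pos A {{A>0}} B {{B>0}}) 0<ε
        N₃ , x~ = cauchy x δ 0<δ
        N₄ , y~ = cauchy y δ 0<δ
    in (N₁ ℕ.⊔ N₂) ℕ.⊔ (N₃ ℕ.⊔ N₄) , λ m n N≤m N≤n →
      let N₁₂≤m = ℕ.m⊔n≤o⇒m≤o (N₁ ℕ.⊔ N₂) (N₃ ℕ.⊔ N₄) N≤m
          N₁₂≤n = ℕ.m⊔n≤o⇒m≤o (N₁ ℕ.⊔ N₂) (N₃ ℕ.⊔ N₄) N≤n
          N₃₄≤m = ℕ.m⊔n≤o⇒n≤o (N₁ ℕ.⊔ N₂) (N₃ ℕ.⊔ N₄) N≤m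
          N₃₄≤n = ℕ.m⊔n≤o⇒n≤o (N₁ ℕ.⊔ N₂) (N₃ ℕ.⊔ N₄) N≤n
      in subst (∣ seq x m ℚ.* seq y m ℚ.- seq x n ℚ.* seq y n ∣ ℚ.≤_) eq
        (product-close (seq x m) (seq y m) (seq x n) (seq y n) A B δ
          {{ℚ.pos⇒nonNeg A {{A>0}}}} {{ℚ.pos⇒nonNeg B {{B>0}}}}
          (x≤A m (ℕ.m⊔n≤o⇒m≤o N₁ N₂ N₁₂≤m)) (y≤B n (ℕ.m⊔n≤o⇒n≤o N₁ N₂ N₁₂≤n))
          (x~ m n (ℕ.m⊔n≤o⇒m≤o N₃ N₄ N₃₄≤m) (ℕ.m⊔n≤o⇒m≤o N₃ N₄ N₃₄≤n))
          (y~ m n (ℕ.m⊔n≤o⇒n≤o N₃ N₄ N₃₄≤m) (ℕ.m⊔n≤o⇒n≤o N₃ N₄ N₃₄≤n)))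

_*ℝ_ : ℝ → ℝ → ℝ
x *ℝ y = mkℝ (λ n → seq x n ℚ.* seq y n) (product-cauchy x y)

-- For n > 0 there is a unique k with  k / M ≤ n^(-1/2) < (k + 1) / M.
FloorRSqrt : ℕ → ℕ → ℕ → Set
FloorRSqrt n M k = k ℕ.* k ℕ.* n ℕ.≤ M ℕ.* M × M ℕ.* M ℕ.< suc k ℕ.* suc k ℕ.* n

floorRSqrt : ∀ n .{{_ : NonZero n}} M → Σ[ k ∈ ℕ ] FloorRSqrt n M k
floorRSqrt n M = search M
  (ℕ.<-≤-trans (ℕ.*-mono-< (ℕ.n<1+n M) (ℕ.n<1+n M)) (ℕ.m≤m*n (suc M ℕ.* suc M) n))
  where
  search : ∀ b → M ℕ.* M ℕ.< suc b ℕ.* suc b ℕ.* n → Σ[ k ∈ ℕ ] FloorRSqrt n M k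
  search zero    M²< = 0 , ℕ.z≤n , M²<
  search (suc b) M²< with suc b ℕ.* suc b ℕ.* n ℕ.≤? M ℕ.* M
  ... | yes ≤M² = suc b , ≤M² , M²<
  ... | no  ≰M² = search b (ℕ.≰⇒> ≰M²)

rsqrtSeq : ∀ n .{{_ : NonZero n}} → ℕ → ℚ
rsqrtSeq n m = ℤ.+ proj₁ (floorRSqrt n (suc m)) ℚ./ suc m

private
  cross-≤ : ∀ n .{{_ : NonZero n}} M M′ k k′ → FloorRSqrt n M k → FloorRSqrt n M′ k′ →
            k ℕ.* M′ ℕ.≤ suc k′ ℕ.* M
  cross-≤ n M M′ k k′ (k²n≤M² , _) (_ , M′²<) with k ℕ.* M′ ℕ.≤? suc k′ ℕ.* M
  ... | yes p = p
  ... | no ¬p = ⊥-elim (ℕ.<-irrefl refl (begin-strict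
    (suc k′ ℕ.* M) ℕ.* (suc k′ ℕ.* M) ℕ.* n  <⟨ ℕ.*-monoˡ-< n (ℕ.*-mono-< (ℕ.≰⇒> ¬p) (ℕ.≰⇒> ¬p)) ⟩
    (k ℕ.* M′) ℕ.* (k ℕ.* M′) ℕ.* n          ≡⟨ eq₁ k M′ n ⟩
    (k ℕ.* k ℕ.* n) ℕ.* (M′ ℕ.* M′)          ≤⟨ ℕ.*-mono-≤ k²n≤M² (ℕ.<⇒≤ M′²<) ⟩
    (M ℕ.* M) ℕ.* (suc k′ ℕ.* suc k′ ℕ.* n)  ≡⟨ eq₂ M (suc k′) n ⟩
    (suc k′ ℕ.* M) ℕ.* (suc k′ ℕ.* M) ℕ.* n  ∎))
    where
    open ℕ.≤-Reasoning
    eq₁ : ∀ a b c → (a ℕ.* b) ℕ.* (a ℕ.* b) ℕ.* c ≡ (a ℕ.* a ℕ.* c) ℕ.* (b ℕ.* b)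
    eq₁ = solve-∀
    eq₂ : ∀ a b c → (a ℕ.* a) ℕ.* (b ℕ.* b ℕ.* c) ≡ (b ℕ.* a) ℕ.* (b ℕ.* a) ℕ.* c
    eq₂ = solve-∀

  /-≤ : ∀ a b m m′ → a ℕ.* suc m′ ℕ.≤ suc b ℕ.* suc m →
        ℤ.+ a ℚ./ suc m ℚ.≤ ℤ.+ b ℚ./ suc m′ ℚ.+ ℤ.+ 1 ℚ./ suc m′
  /-≤ a b m m′ p = ℚ.toℚᵘ-cancel-≤ (begin
    toℚᵘ (ℤ.+ a ℚ./ suc m)                                 ≃⟨ ℚ.toℚᵘ-fromℚᵘ (ℚᵘ.mkℚᵘ (ℤ.+ a) m) ⟩
    ℚᵘ.mkℚᵘ (ℤ.+ a) m                                      ≤⟨ ℚᵘ.*≤* (subst₂ ℤ._≤_ (ℤ.pos-* a D) (trans (cong ℤ.+_ (eq b (suc m) (suc m′))) num) (ℤ.+≤+ q)) ⟩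
    ℚᵘ.mkℚᵘ (ℤ.+ b) m′ ℚᵘ.+ ℚᵘ.mkℚᵘ (ℤ.+ 1) m′             ≃⟨ ℚᵘ.≃-sym (ℚᵘ.+-cong (ℚ.toℚᵘ-fromℚᵘ (ℚᵘ.mkℚᵘ (ℤ.+ b) m′)) (ℚ.toℚᵘ-fromℚᵘ (ℚᵘ.mkℚᵘ (ℤ.+ 1) m′))) ⟩
    toℚᵘ (ℤ.+ b ℚ./ suc m′) ℚᵘ.+ toℚᵘ (ℤ.+ 1 ℚ./ suc m′)   ≃⟨ ℚᵘ.≃-sym (ℚ.toℚᵘ-homo-+ (ℤ.+ b ℚ./ suc m′) (ℤ.+ 1 ℚ./ suc m′)) ⟩
    toℚᵘ (ℤ.+ b ℚ./ suc m′ ℚ.+ ℤ.+ 1 ℚ./ suc m′)           ∎)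
    where
    open ℚᵘ.≤-Reasoning
    D = suc m′ ℕ.* suc m′
    q : a ℕ.* D ℕ.≤ suc b ℕ.* suc m ℕ.* suc m′
    q = subst (ℕ._≤ suc b ℕ.* suc m ℕ.* suc m′) (ℕ.*-assoc a (suc m′) (suc m′))
          (ℕ.*-monoˡ-≤ (suc m′) p)
    eq : ∀ x y z → suc x ℕ.* y ℕ.* z ≡ (x ℕ.* z ℕ.+ 1 ℕ.* z) ℕ.* y
    eq = solve-∀
    num : ℤ.+ ((b ℕ.* suc m′ ℕ.+ 1 ℕ.* suc m′) ℕ.* suc m)
        ≡ (ℤ.+ b ℤ.* ℤ.+ suc m′ ℤ.+ ℤ.+ 1 ℤ.* ℤ.+ suc m′) ℤ.* ℤ.+ suc m
    num = trans (ℤ.pos-* (b ℕ.* suc m′ ℕ.+ 1 ℕ.* suc m′) (suc m))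
      (cong (ℤ._* ℤ.+ suc m) (cong₂ ℤ._+_ (ℤ.pos-* b (suc m′)) (ℤ.pos-* 1 (suc m′))))

  archimedean : ∀ ε → 0ℚ ℚ.< ε → ∀ m → ℚ.denominatorℕ ε ℕ.≤ suc m → ℤ.+ 1 ℚ./ suc m ℚ.≤ ε
  archimedean (ℚ.mkℚ (ℤ.+ zero) d c)     (ℚ.*<* (ℤ.+<+ ())) m _
  archimedean (ℚ.mkℚ (ℤ.-[1+ _ ]) d c)   (ℚ.*<* ())         m _
  archimedean ε@(ℚ.mkℚ (ℤ.+ suc a) d c)  _                  m d≤m = ℚ.toℚᵘ-cancel-≤ (begin
    toℚᵘ (ℤ.+ 1 ℚ./ suc m)  ≃⟨ ℚ.toℚᵘ-fromℚᵘ (ℚᵘ.mkℚᵘ (ℤ.+ 1) m) ⟩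
    ℚᵘ.mkℚᵘ (ℤ.+ 1) m       ≤⟨ ℚᵘ.*≤* (ℤ.+≤+ (ℕ.*-mono-≤ {1} {suc a} (ℕ.s≤s ℕ.z≤n) d≤m)) ⟩
    toℚᵘ ε                  ∎)
    where open ℚᵘ.≤-Reasoning

  ∣-∣≤ : ∀ {p q ε} → p ℚ.≤ q ℚ.+ ε → q ℚ.≤ p ℚ.+ ε → ∣ p ℚ.- q ∣ ℚ.≤ ε
  ∣-∣≤ {p} {q} {ε} p≤ q≤ with ℚ.∣p∣≡p∨∣p∣≡-p (p ℚ.- q)
  ... | inj₁ e = subst₂ ℚ._≤_ (sym e)
    (solve 2 (λ b e → b :+ e :- b := e) refl q ε) (ℚ.+-monoˡ-≤ (ℚ.- q) p≤)
    where open +-*-Solver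
  ... | inj₂ e = subst₂ ℚ._≤_
    (trans (solve 2 (λ a b → b :- a := :- (a :- b)) refl p q) (sym e))
    (solve 2 (λ b e → b :+ e :- b := e) refl p ε) (ℚ.+-monoˡ-≤ (ℚ.- p) q≤)
    where open +-*-Solver

-- The real number n^(-1/2), as the limit of ⌊ M n^(-1/2) ⌋ / M.
_^-½ : ∀ n .{{_ : NonZero n}} → ℝ
n ^-½ = mkℝ (rsqrtSeq n) λ ε 0<ε → ℚ.denominatorℕ ε , λ m m′ N≤m N≤m′ →
  ∣-∣≤ (step ε 0<ε m m′ N≤m′) (step ε 0<ε m′ m N≤m)
  where
  step : ∀ ε → 0ℚ ℚ.< ε → ∀ m m′ → ℚ.denominatorℕ ε ℕ.≤ m′ →
         rsqrtSeq n m ℚ.≤ rsqrtSeq n m′ ℚ.+ ε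
  step ε 0<ε m m′ N≤m′ with floorRSqrt n (suc m) | floorRSqrt n (suc m′)
  ... | k , fk | k′ , fk′ = ℚ.≤-trans (/-≤ k k′ m m′ (cross-≤ n (suc m) (suc m′) k k′ fk fk′))
    (ℚ.+-monoʳ-≤ (ℤ.+ k′ ℚ./ suc m′) (archimedean ε 0<ε m′ (ℕ.m≤n⇒m≤1+n N≤m′)))

------------------------------------------------------------------------
-- Bipartite graphs with n vertices on each side

-- The pair (i , j) stands for the edge between the i-th vertex of the
-- left side and the j-th vertex of the right side.
Edge : ℕ → Set
Edge n = Fin n × Fin n

EdgeSet : ℕ → Set
EdgeSet n = Edge n → Bool

BipartiteGraph : ℕ → Set
BipartiteGraph = EdgeSet

infix 4 _∈_ _⊆_

_∈_ : ∀ {n} → Edge n → EdgeSet n → Set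
e ∈ S = T (S e)

_⊆_ : ∀ {n} → EdgeSet n → EdgeSet n → Set
S ⊆ S′ = ∀ e → e ∈ S → e ∈ S′

size : ∀ {n} → EdgeSet n → ℕ
size {n} S = length (filterᵇ S (cartesianProduct (allFin n) (allFin n)))

Vertex : ℕ → Set
Vertex n = Fin n ⊎ Fin n

vertices : ∀ n → List (Vertex n)
vertices n = map inj₁ (allFin n) ++ map inj₂ (allFin n)

degree : ∀ {n} → BipartiteGraph n → Vertex n → ℕ
degree {n} G (inj₁ i) = length (filterᵇ (λ j → G (i , j)) (allFin n))
degree {n} G (inj₂ j) = length (filterᵇ (λ i → G (i , j)) (allFin n))

averageDegree : ∀ {n} .{{_ : NonZero n}} → BipartiteGraph n → ℚ
averageDegree {n} G =
  (ℤ.+ sum (map (degree G) (vertices n)) ℚ./ (2 ℕ.* n)) {{ℕ.m*n≢0 2 n}}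

ShareVertex : ∀ {n} → Edge n → Edge n → Set
ShareVertex (i , j) (k , l) = i ≡ k ⊎ j ≡ l

IsMatching : ∀ {n} → EdgeSet n → Set
IsMatching S = ∀ e f → e ∈ S → f ∈ S → e ≢ f → ¬ ShareVertex e f

-- Only a left and a right vertex can be adjacent, which leaves two ways
-- for an edge of G to connect an end of one edge to an end of the other.
JoinedIn : ∀ {n} → BipartiteGraph n → Edge n → Edge n → Set
JoinedIn G (i , j) (k , l) = (i , l) ∈ G ⊎ (k , j) ∈ G

IsInducedIn : ∀ {n} → BipartiteGraph n → EdgeSet n → Set
IsInducedIn G S = ∀ e f → e ∈ S → f ∈ S → e ≢ f → ¬ JoinedIn G e f

IsMultitasker : ∀ {n} → ℝ → BipartiteGraph n → Set
IsMultitasker α G = ∀ M → M ⊆ G → IsMatching M → 1 ℕ.≤ size M →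
  ∃[ M′ ] (M′ ⊆ M × IsMatching M′ × IsInducedIn G M′ ×
           α *ℝ fromℕ (size M) ≤ℝ fromℕ (size M′))

{-# OPTIONS --safe #-}
module Submission where

-- Fix K of order 1/c and let every left vertex independently pick each right vertex with
-- probability 1/(Kn), and nothing with the remaining probability. The picked edges of G,
-- less the collisions at right vertices, form a matching whose expected size is at least of
-- order n/K². For an induced matching (a₁ , b₁), …, (aₘ , bₘ), listed in the order of the
-- left vertices, bᵢ lies in N(aᵢ) minus the union of the earlier N(aⱼ). For fixed left
-- vertices these sets are disjoint, so b₁, …, bₘ can be chosen in at most nᵐ/m! ways, and
-- the expected number of such m-tuples among the picks is at most (nᵐ/m!)² (Kn)⁻ᵐ. This
-- is below 1/(2K²) once m is a suitable constant times √n, hence some outcome has a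
-- matching of size more than n/(2K²) and no induced submatching of size m.

open import Defs
open import Data.Nat using (ℕ; NonZero)
open import Data.Product using (_×_; ∃-syntax)
open import Data.Bool using (Bool; true; false; T; _∧_; not; if_then_else_)
open import Data.Empty using (⊥-elim)
open import Data.Fin using (Fin; _≟_)
open import Data.Fin.Properties using (injective⇒≤)
import Data.Integer as ℤ
import Data.Integer.Properties as ℤ
open import Data.List using (List; []; _∷_; allFin; cartesianProduct; filterᵇ; length; lookup; map)
open import Data.List.Properties using (length-tabulate; map-++; map-∘)
open import Data.List.Membership.Propositional using () renaming (_∈_ to _∈ˡ_)
import Data.List.Membership.DecPropositional as DecMembership
open import Data.List.Membership.Propositional.Properties
  using (∈-lookup; ∈-filter⁺; ∈-filter⁻; ∈-allFin; ∈-cartesianProduct⁺; ∈-AllPairs₂)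
open import Data.List.Relation.Unary.All as All using (All; []; _∷_)
open import Data.List.Relation.Unary.AllPairs as AllPairs using (AllPairs; []; _∷_)
open import Data.List.Relation.Unary.Any using (here; there; index)
open import Data.List.Relation.Unary.Any.Properties using (lookup-index)
open import Data.List.Relation.Unary.Unique.Propositional using (Unique)
import Data.List.Relation.Unary.Unique.Propositional.Properties as Unique
open import Data.Nat using (zero; suc; >-nonZero; >-nonZero⁻¹; _+_; _*_; _^_; _!; _≤_; _<_; _≡ᵇ_; _⊔_; z≤n; s≤s)
open import Data.Nat.ListAction using (sum)
open import Data.Nat.ListAction.Properties using (sum-++)
open import Data.Nat.Properties hiding (_≟_)
open import Data.Nat.Tactic.RingSolver using (solve-∀)
open import Data.Product using (_,_; proj₁; proj₂)
open import Data.Product.Properties using (≡-dec)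
open import Data.Rational as ℚ using (0ℚ; 1ℚ; toℚᵘ)
import Data.Rational.Properties as ℚ
open import Data.Rational.Unnormalised as ℚᵘ using (mkℚᵘ)
import Data.Rational.Unnormalised.Properties as ℚᵘ
open import Data.Sum as Sum using (inj₁; inj₂)
open import Function using (_∘_; id)
open import Relation.Binary.PropositionalEquality
  using (_≡_; _≢_; refl; sym; trans; cong; cong₂; subst; subst₂)
open import Relation.Nullary using (¬_; Dec; does; yes; no)
open import Relation.Nullary.Decidable using (T?; ⌊_⌋; toWitness; fromWitness)

-- Finite sums, indicators and counting in lists.

𝟙 : Bool → ℕ
𝟙 false = 0
𝟙 true  = 1

∑ : ∀ {A : Set} → List A → (A → ℕ) → ℕ
∑ xs F = sum (map F xs)

module _ {A : Set} where

  ∑-mono : ∀ (xs : List A) {F H : A → ℕ} → (∀ x → F x ≤ H x) → ∑ xs F ≤ ∑ xs H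
  ∑-mono []       le = z≤n
  ∑-mono (x ∷ xs) le = +-mono-≤ (le x) (∑-mono xs le)

  ∑-cong : ∀ (xs : List A) {F H : A → ℕ} → (∀ x → F x ≡ H x) → ∑ xs F ≡ ∑ xs H
  ∑-cong []       eq = refl
  ∑-cong (x ∷ xs) eq = cong₂ _+_ (eq x) (∑-cong xs eq)

  ∑-+ : ∀ (xs : List A) (F H : A → ℕ) → ∑ xs (λ x → F x + H x) ≡ ∑ xs F + ∑ xs H
  ∑-+ []       F H = refl
  ∑-+ (x ∷ xs) F H = trans (cong (F x + H x +_) (∑-+ xs F H))
                           (eq (F x) (H x) (∑ xs F) (∑ xs H))
    where
    eq : ∀ a b c d → a + b + (c + d) ≡ (a + c) + (b + d)
    eq = solve-∀

  ∑-*ˡ : ∀ (xs : List A) c (F : A → ℕ) → ∑ xs (λ x → c * F x) ≡ c * ∑ xs F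
  ∑-*ˡ []       c F = sym (*-zeroʳ c)
  ∑-*ˡ (x ∷ xs) c F = trans (cong (c * F x +_) (∑-*ˡ xs c F)) (sym (*-distribˡ-+ c (F x) (∑ xs F)))

  ∑-*ʳ : ∀ (xs : List A) (F : A → ℕ) c → ∑ xs (λ x → F x * c) ≡ ∑ xs F * c
  ∑-*ʳ xs F c = trans (∑-cong xs (λ x → *-comm (F x) c)) (trans (∑-*ˡ xs c F) (*-comm c (∑ xs F)))

  ∑-const : ∀ (xs : List A) c → ∑ xs (λ _ → c) ≡ length xs * c
  ∑-const []       c = refl
  ∑-const (x ∷ xs) c = cong (c +_) (∑-const xs c)

  ∑-<-witness : ∀ (xs : List A) {F H : A → ℕ} → ∑ xs F < ∑ xs H → ∃[ x ] F x < H x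
  ∑-<-witness (x ∷ xs) {F} {H} lt with F x <? H x
  ... | yes p = x , p
  ... | no ¬p = ∑-<-witness xs (+-cancelˡ-< (H x) _ _ (<-≤-trans (s≤s (+-monoˡ-≤ (∑ xs F) (≮⇒≥ ¬p))) lt))

  length-filterᵇ : ∀ (p : A → Bool) xs → length (filterᵇ p xs) ≡ ∑ xs (𝟙 ∘ p)
  length-filterᵇ p []       = refl
  length-filterᵇ p (x ∷ xs) with p x
  ... | true  = cong suc (length-filterᵇ p xs)
  ... | false = length-filterᵇ p xs

  lookup-injective : ∀ {xs : List A} → Unique xs → ∀ i j → lookup xs i ≡ lookup xs j → i ≡ j
  lookup-injective (_  ∷ _) Fin.zero    Fin.zero    _  = refl
  lookup-injective (x∉ ∷ _) Fin.zero    (Fin.suc j) eq = ⊥-elim (All.lookup x∉ (∈-lookup j) eq)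
  lookup-injective (x∉ ∷ _) (Fin.suc i) Fin.zero    eq = ⊥-elim (All.lookup x∉ (∈-lookup i) (sym eq))
  lookup-injective (_  ∷ u) (Fin.suc i) (Fin.suc j) eq = cong Fin.suc (lookup-injective u i j eq)

  -- Pigeonhole: sending a position in `xs` to a position in `ys` that holds the same element is
  -- injective, because `xs` has no repetitions.
  unique-⊆-length : ∀ {xs ys : List A} → Unique xs → (∀ {x} → x ∈ˡ xs → x ∈ˡ ys) →
                    length xs ≤ length ys
  unique-⊆-length {xs} {ys} uniq sub = injective⇒≤ {f = λ i → index (sub (∈-lookup i))} λ {i} {j} eq →
    lookup-injective uniq i j
      (trans (lookup-index (sub (∈-lookup i)))
        (trans (cong (lookup ys) eq) (sym (lookup-index (sub (∈-lookup j))))))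

∑-swap : ∀ {A B : Set} (xs : List A) (ys : List B) (F : A → B → ℕ) →
         ∑ xs (λ x → ∑ ys (F x)) ≡ ∑ ys (λ y → ∑ xs (λ x → F x y))
∑-swap []       ys F = sym (trans (∑-const ys 0) (*-zeroʳ (length ys)))
∑-swap (x ∷ xs) ys F = trans (cong (∑ ys (F x) +_) (∑-swap xs ys F))
                             (sym (∑-+ ys (F x) (λ y → ∑ xs (λ x → F x y))))

length-allFin : ∀ n → length (allFin n) ≡ n
length-allFin n = length-tabulate id

∑-allFin-const : ∀ n c → ∑ (allFin n) (λ _ → c) ≡ n * c
∑-allFin-const n c = trans (∑-const (allFin n) c) (cong (_* c) (length-allFin n))

∑-≟-≤1 : ∀ {n} (i : Fin n) → ∑ (allFin n) (λ j → 𝟙 (does (i ≟ j))) ≤ 1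
∑-≟-≤1 {n} i = subst (_≤ 1) (length-filterᵇ (λ j → does (i ≟ j)) (allFin n))
  (unique-⊆-length {ys = i ∷ []} (Unique.filter⁺ (T? ∘ λ j → does (i ≟ j)) (Unique.allFin⁺ n))
    λ {j} j∈ → here (eq j (proj₂ (∈-filter⁻ (T? ∘ λ j → does (i ≟ j)) {xs = allFin n} j∈))))
  where
  eq : ∀ j → T (does (i ≟ j)) → j ≡ i
  eq j t with i ≟ j
  ... | yes refl = refl

-- Inequalities for powers and factorials.

-- These are the first two terms of the binomial expansion of the right side. The induction step
-- discards a term quadratic in `q`.
bernoulli : ∀ m u q → u ^ suc m + suc m * q * u ^ m ≤ (u + q) ^ suc m
bernoulli zero    u q = ≤-reflexive (eq u q)
  where
  eq : ∀ u q → u * 1 + 1 * q * 1 ≡ (u + q) * 1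
  eq = solve-∀
bernoulli (suc m) u q = begin
  u * (u * u ^ m) + suc (suc m) * q * (u * u ^ m)
    ≤⟨ m≤m+n _ _ ⟩
  u * (u * u ^ m) + suc (suc m) * q * (u * u ^ m) + q * (suc m * q * u ^ m)
    ≡⟨ eq m u q (u ^ m) ⟩
  (u + q) * (u * u ^ m + suc m * q * u ^ m)
    ≤⟨ *-monoʳ-≤ (u + q) (bernoulli m u q) ⟩
  (u + q) * (u + q) ^ suc m ∎
  where
  open ≤-Reasoning
  eq : ∀ m u q p → u * (u * p) + suc (suc m) * q * (u * p) + q * (suc m * q * p)
                 ≡ (u + q) * (u * p + suc m * q * p)
  eq = solve-∀

-- Beyond `j !`, the factorial on the right has `i` further factors, each larger than `j`.
^*!≤! : ∀ j i → j ^ i * j ! ≤ (i + j) !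
^*!≤! j zero    = ≤-reflexive (+-identityʳ (j !))
^*!≤! j (suc i) = begin
  j * j ^ i * j !      ≡⟨ *-assoc j (j ^ i) (j !) ⟩
  j * (j ^ i * j !)    ≤⟨ *-mono-≤ (≤-trans (m≤n+m j i) (n≤1+n (i + j))) (^*!≤! j i) ⟩
  suc (i + j) * (i + j) ! ∎
  where open ≤-Reasoning

^-distribʳ-* : ∀ a b m → (a * b) ^ m ≡ a ^ m * b ^ m
^-distribʳ-* a b zero    = refl
^-distribʳ-* a b (suc m) = trans (cong (a * b *_) (^-distribʳ-* a b m)) (eq a b (a ^ m) (b ^ m))
  where
  eq : ∀ a b c d → a * b * (c * d) ≡ a * c * (b * d)
  eq = solve-∀

-- A weak form of Stirling's bound, restricted to powers of two so that the induction can double m: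
-- of the two factors m^m in (2m)^(2m) = 4^m m^m m^m, one is bounded by induction, and the other
-- combines with m! into (2m)!.
m^m≤4^m*m! : ∀ t → let m = 2 ^ t in m ^ m ≤ 4 ^ m * m !
m^m≤4^m*m! zero    = s≤s z≤n
m^m≤4^m*m! (suc t) = subst (λ k → k ^ k ≤ 4 ^ k * k !) (cong (2 ^ t +_) (sym (+-identityʳ (2 ^ t)))) (begin
  (m + m) ^ (m + m)                        ≡⟨ cong (_^ (m + m)) (cong (m +_) (sym (+-identityʳ m))) ⟩
  (2 * m) ^ (m + m)                        ≡⟨ ^-distribˡ-+-* (2 * m) m m ⟩
  (2 * m) ^ m * (2 * m) ^ m                ≡⟨ cong₂ _*_ (^-distribʳ-* 2 m m) (^-distribʳ-* 2 m m) ⟩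
  (2 ^ m * m ^ m) * (2 ^ m * m ^ m)        ≡⟨ eq₁ (2 ^ m) (m ^ m) ⟩
  (2 ^ m * 2 ^ m) * m ^ m * m ^ m          ≡⟨ cong (λ z → z * m ^ m * m ^ m) (sym (^-distribʳ-* 2 2 m)) ⟩
  4 ^ m * m ^ m * m ^ m                    ≤⟨ *-monoʳ-≤ (4 ^ m * m ^ m) (m^m≤4^m*m! t) ⟩
  4 ^ m * m ^ m * (4 ^ m * m !)            ≡⟨ eq₂ (4 ^ m) (m ^ m) (m !) ⟩
  (4 ^ m * 4 ^ m) * (m ^ m * m !)          ≤⟨ *-mono-≤ (≤-reflexive (sym (^-distribˡ-+-* 4 m m))) (^*!≤! m m) ⟩
  4 ^ (m + m) * (m + m) !                  ∎)
  where
  open ≤-Reasoning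
  m = 2 ^ t
  eq₁ : ∀ a b → (a * b) * (a * b) ≡ (a * a) * b * b
  eq₁ = solve-∀
  eq₂ : ∀ a b c → a * b * (a * c) ≡ (a * a) * (b * c)
  eq₂ = solve-∀

-- Consecutive powers of 4 differ by a factor 4. As x grows by one, the exponent changes only when x
-- was itself a power of 4, and then the next power is exactly 4x.
square-between : ∀ x → 1 ≤ x → ∃[ t ] (x ≤ 2 ^ t * 2 ^ t × 2 ^ t * 2 ^ t < 4 * x)
square-between (suc zero)    _ = 0 , s≤s z≤n , s≤s (s≤s z≤n)
square-between (suc (suc x)) _ with square-between (suc x) (s≤s z≤n)
... | t , x≤ , <4x with suc (suc x) ≤? 2 ^ t * 2 ^ t
...   | yes p = t , p , <-≤-trans <4x (*-monoʳ-≤ 4 (n≤1+n (suc x)))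
...   | no ¬p = suc t , subst (suc (suc x) ≤_) eq below
                      , subst (_< 4 * suc (suc x)) eq (*-monoʳ-< 4 (n<1+n (suc x)))
  where
  x≡ : suc x ≡ 2 ^ t * 2 ^ t
  x≡ = ≤-antisym x≤ (≤-pred (≰⇒> ¬p))
  quad : ∀ y → 4 * (y * y) ≡ (2 * y) * (2 * y)
  quad = solve-∀
  eq : 4 * suc x ≡ 2 ^ suc t * 2 ^ suc t
  eq = trans (cong (4 *_) x≡) (quad (2 ^ t))
  below : suc (suc x) ≤ 4 * suc x
  below = subst (suc (suc x) ≤_) (*-comm (suc x) 4) (m<m*n (suc x) 4 (s≤s (s≤s z≤n)))

-- Random picks and linearity of expectation.

-- A pick list arises by letting each left vertex of the given list pick either one of
-- its n edges of K_{n,n} or, with weight w, nothing; total adds F up over all outcomes.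
module Picks (n w : ℕ) where

  total : List (Fin n) → (List (Edge n) → ℕ) → ℕ
  total []       F = F []
  total (a ∷ as) F = ∑ (allFin n) (λ j → total as (λ l → F ((a , j) ∷ l))) + w * total as F

  -- The outcomes over which `total` sums, with their weights forgotten.
  data PickedFrom : List (Fin n) → List (Edge n) → Set where
    none : PickedFrom [] []
    skip : ∀ {a as l} → PickedFrom as l → PickedFrom (a ∷ as) l
    pick : ∀ {a as l} j → PickedFrom as l → PickedFrom (a ∷ as) ((a , j) ∷ l)

  -- With c = 1 this is the total weight of all outcomes, the factor by which `total` exceeds an
  -- expectation. Later bounds carry it as a power of `n + w` in place of a division.
  total-const : ∀ as c → total as (λ _ → c) ≡ (n + w) ^ length as * c
  total-const []       c = sym (+-identityʳ c)
  total-const (a ∷ as) c = trans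
    (cong (_+ w * total as (λ _ → c)) (∑-allFin-const n (total as (λ _ → c))))
    (trans (cong (λ t → n * t + w * t) (total-const as c)) (eq n w ((n + w) ^ length as) c))
    where
    eq : ∀ n w p c → n * (p * c) + w * (p * c) ≡ (n + w) * p * c
    eq = solve-∀

  total-+ : ∀ as (F H : List (Edge n) → ℕ) → total as (λ l → F l + H l) ≡ total as F + total as H
  total-+ []       F H = refl
  total-+ (a ∷ as) F H = trans
    (cong₂ _+_
      (trans (∑-cong (allFin n) λ j → total-+ as (λ l → F ((a , j) ∷ l)) (λ l → H ((a , j) ∷ l)))
             (∑-+ (allFin n) (λ j → total as (λ l → F ((a , j) ∷ l))) (λ j → total as (λ l → H ((a , j) ∷ l)))))
      (cong (w *_) (total-+ as F H)))
    (eq (∑ (allFin n) (λ j → total as (λ l → F ((a , j) ∷ l)))) (∑ (allFin n) (λ j → total as (λ l → H ((a , j) ∷ l))))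
        w (total as F) (total as H))
    where
    eq : ∀ p q w f h → p + q + w * (f + h) ≡ (p + w * f) + (q + w * h)
    eq = solve-∀

  total-*ˡ : ∀ as c (F : List (Edge n) → ℕ) → total as (λ l → c * F l) ≡ c * total as F
  total-*ˡ []       c F = refl
  total-*ˡ (a ∷ as) c F = trans
    (cong₂ _+_
      (trans (∑-cong (allFin n) λ j → total-*ˡ as c (λ l → F ((a , j) ∷ l)))
             (∑-*ˡ (allFin n) c (λ j → total as (λ l → F ((a , j) ∷ l)))))
      (cong (w *_) (total-*ˡ as c F)))
    (eq _ c w (total as F))
    where
    eq : ∀ p c w f → c * p + w * (c * f) ≡ c * (p + w * f)
    eq = solve-∀

  -- The first moment method. If the outcomes that skip `a` do not show the strict inequality, the
  -- picks at `a` must, and then those of some single right vertex do.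
  total-<-witness : ∀ as {F H : List (Edge n) → ℕ} → total as F < total as H →
                    ∃[ l ] (PickedFrom as l × F l < H l)
  total-<-witness []       lt = [] , none , lt
  total-<-witness (a ∷ as) {F} {H} lt with total as F <? total as H
  ... | yes p = let l , from , F<H = total-<-witness as p in l , skip from , F<H
  ... | no ¬p =
    let j , p = ∑-<-witness (allFin n) (+-cancelʳ-< (w * total as H) _ _
          (≤-<-trans (+-monoʳ-≤ _ (*-monoʳ-≤ w (≮⇒≥ ¬p))) lt))
        l , from , F<H = total-<-witness as p
    in (a , j) ∷ l , pick j from , F<H

  length-picked : ∀ {as l} → PickedFrom as l → length l ≤ length as
  length-picked none          = z≤n
  length-picked (skip from)   = m≤n⇒m≤1+n (length-picked from)
  length-picked (pick _ from) = s≤s (length-picked from)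

  DistinctLeft : List (Edge n) → Set
  DistinctLeft = AllPairs (λ e f → proj₁ e ≢ proj₁ f)

  distinctLeft-picked : ∀ {as l} → Unique as → PickedFrom as l → DistinctLeft l
  distinctLeft-picked _         none          = []
  distinctLeft-picked (_ ∷ u)   (skip from)   = distinctLeft-picked u from
  distinctLeft-picked (a∉ ∷ u)  (pick j from) = picked-≢ a∉ from ∷ distinctLeft-picked u from
    where
    picked-≢ : ∀ {a as l} → All (a ≢_) as → PickedFrom as l → All (λ e → a ≢ proj₁ e) l
    picked-≢ []         none          = []
    picked-≢ (_  ∷ a≢)  (skip from)   = picked-≢ a≢ from
    picked-≢ (a≢a′ ∷ a≢) (pick _ from) = a≢a′ ∷ picked-≢ a≢ from

  -- Expected numbers of picked edges and of collisions.

  hits : Fin n → List (Edge n) → ℕ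
  hits j l = ∑ l (λ e → 𝟙 (does (j ≟ proj₂ e)))

  collisions : List (Edge n) → ℕ
  collisions []            = 0
  collisions ((a , j) ∷ l) = hits j l + collisions l

  -- Linearity of expectation: an edge at a listed vertex is picked with probability 1/(n + w).
  -- Denominators are cleared.
  total-∑ : ∀ as (p : Edge n → Bool) →
    total as (λ l → ∑ l (𝟙 ∘ p)) * (n + w) ≡
    (n + w) ^ length as * ∑ as (λ a → ∑ (allFin n) (λ j → 𝟙 (p (a , j))))
  total-∑ []       p = refl
  total-∑ (a ∷ as) p = trans (cong (_* (n + w)) (trans
    (cong (_+ w * T₀) (trans
      (∑-cong (allFin n) λ j → trans (total-+ as (λ _ → 𝟙 (p (a , j))) (λ l → ∑ l (𝟙 ∘ p)))
                                     (cong (_+ T₀) (total-const as (𝟙 (p (a , j))))))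
      (trans (∑-+ (allFin n) (λ j → P * 𝟙 (p (a , j))) (λ _ → T₀))
             (cong₂ _+_ (∑-*ˡ (allFin n) P (λ j → 𝟙 (p (a , j)))) (∑-allFin-const n T₀)))))
    (eq₁ P d n T₀ w)))
    (trans (eq₂ P d n w T₀) (trans (cong (λ t → (n + w) * (P * d + t)) (total-∑ as p))
       (eq₃ (n + w) P d (∑ as (λ a → ∑ (allFin n) (λ j → 𝟙 (p (a , j))))))))
    where
    P = (n + w) ^ length as
    T₀ = total as (λ l → ∑ l (𝟙 ∘ p))
    d = ∑ (allFin n) (λ j → 𝟙 (p (a , j)))
    eq₁ : ∀ P d n T w → P * d + n * T + w * T ≡ P * d + (n + w) * T
    eq₁ = solve-∀
    eq₂ : ∀ P d n w T → (P * d + (n + w) * T) * (n + w) ≡ (n + w) * (P * d + T * (n + w))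
    eq₂ = solve-∀
    eq₃ : ∀ N P d s → N * (P * d + P * s) ≡ N * P * (d + s)
    eq₃ = solve-∀

  total-hits : ∀ as j → total as (hits j) * (n + w) ≤ (n + w) ^ length as * length as
  total-hits as j = begin
    total as (hits j) * (n + w)                      ≡⟨ total-∑ as (λ e → does (j ≟ proj₂ e)) ⟩
    P * ∑ as (λ _ → ∑ (allFin n) (λ i → 𝟙 (does (j ≟ i))))
                                                     ≤⟨ *-monoʳ-≤ P (∑-mono as λ _ → ∑-≟-≤1 j) ⟩
    P * ∑ as (λ _ → 1)                               ≡⟨ cong (P *_) (trans (∑-const as 1) (*-identityʳ (length as))) ⟩
    P * length as                                    ∎
    where
    open ≤-Reasoning
    P = (n + w) ^ length as

  -- Two given left vertices pick the same right vertex with probability n/N². A new vertex adds r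
  -- such pairs to r earlier ones' pairs, and r² + r ≤ (r + 1)² keeps the generous count r² going.
  total-collisions : ∀ as → let N = n + w; r = length as in
    total as collisions * (N * N) ≤ n * (r * r) * N ^ r
  total-collisions []       = z≤n
  total-collisions (a ∷ as) = begin
    (∑ (allFin n) (λ j → total as (λ l → hits j l + collisions l)) + w * T₀) * (N * N)
      ≡⟨ cong (λ t → (t + w * T₀) * (N * N)) (trans
           (∑-cong (allFin n) λ j → total-+ as (hits j) collisions)
           (trans (∑-+ (allFin n) (λ j → total as (hits j)) (λ _ → T₀))
                  (cong (H +_) (∑-allFin-const n T₀)))) ⟩
    (H + n * T₀ + w * T₀) * (N * N)
      ≡⟨ eq₁ H n w T₀ ⟩
    H * N * N + N * (T₀ * (N * N))
      ≤⟨ +-mono-≤ (*-monoˡ-≤ N H≤) (*-monoʳ-≤ N (total-collisions as)) ⟩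
    n * (P * r) * N + N * (n * (r * r) * P)
      ≤⟨ m≤m+n _ (N * P * n * (r + 1)) ⟩
    n * (P * r) * N + N * (n * (r * r) * P) + N * P * n * (r + 1)
      ≡⟨ eq₂ n P r N ⟩
    n * (suc r * suc r) * (N * P) ∎
    where
    open ≤-Reasoning
    N = n + w
    r = length as
    P = N ^ r
    T₀ = total as collisions
    H = ∑ (allFin n) (λ j → total as (hits j))
    H≤ : H * N ≤ n * (P * r)
    H≤ = begin
      H * N                                        ≡⟨ ∑-*ʳ (allFin n) (λ j → total as (hits j)) N ⟨
      ∑ (allFin n) (λ j → total as (hits j) * N)   ≤⟨ ∑-mono (allFin n) (total-hits as) ⟩
      ∑ (allFin n) (λ _ → P * r)                   ≡⟨ ∑-allFin-const n (P * r) ⟩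
      n * (P * r)                                  ∎
    eq₁ : ∀ H n w T → (H + n * T + w * T) * ((n + w) * (n + w)) ≡ H * (n + w) * (n + w) + (n + w) * (T * ((n + w) * (n + w)))
    eq₁ = solve-∀
    eq₂ : ∀ n P r N → n * (P * r) * N + N * (n * (r * r) * P) + N * P * n * (r + 1) ≡ n * (suc r * suc r) * (N * P)
    eq₂ = solve-∀

  -- Chains and their expected number.

  module _ (G : BipartiteGraph n) where

    _∖N_ : (Fin n → Bool) → Fin n → (Fin n → Bool)
    (B ∖N a) j = B j ∧ not (G (a , j))

    -- The number of ways to choose edges (a₁ , b₁), …, (aₘ , bₘ) of G, in this order, from
    -- the pick list with every bᵢ in B and no edge of G from aᵢ to bⱼ for i < j.
    chains : ℕ → List (Edge n) → (Fin n → Bool) → ℕ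
    chains zero    _             B = 1
    chains (suc m) []            B = 0
    chains (suc m) ((a , j) ∷ l) B =
      chains (suc m) l B + 𝟙 (B j ∧ G (a , j)) * chains m l (B ∖N a)

    ∣_∣ᴮ : (Fin n → Bool) → ℕ
    ∣ B ∣ᴮ = ∑ (allFin n) (𝟙 ∘ B)

    split-neighbours : ∀ B a →
      ∣ B ∣ᴮ ≡ ∣ B ∖N a ∣ᴮ + ∑ (allFin n) (λ j → 𝟙 (B j ∧ G (a , j)))
    split-neighbours B a = trans (∑-cong (allFin n) λ j → split (B j) (G (a , j)))
      (∑-+ (allFin n) (𝟙 ∘ (B ∖N a)) (λ j → 𝟙 (B j ∧ G (a , j))))
      where
      split : ∀ b g → 𝟙 b ≡ 𝟙 (b ∧ not g) + 𝟙 (b ∧ g)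
      split false _     = refl
      split true  false = refl
      split true  true  = refl

    -- Induction on the left vertices. Picking one of the q neighbours of `a` in B leaves u = |B| -
    -- q right vertices for the rest of the chain. One factor m! accounts for the order of the left
    -- vertices, the other for the disjoint neighbourhoods on the right.
    total-chains : ∀ m as B → let N = n + w; r = length as in
      total as (λ l → chains m l B) * N ^ m * (m ! * m !) ≤ N ^ r * (r ^ m * ∣ B ∣ᴮ ^ m)
    total-chains zero    as       B = ≤-reflexive
      (trans (*-identityʳ _) (trans (*-identityʳ _) (total-const as 1)))
    total-chains (suc m) []       B = z≤n
    total-chains (suc m) (a ∷ as) B = begin
      (∑ (allFin n) (λ j → total as (λ l → chains (suc m) l B + 𝟙 (B j ∧ G (a , j)) * chains m l (B ∖N a)))
        + w * T₁) * (N * M) * (suc m * φ * (suc m * φ))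
        ≡⟨ cong (λ t → (t + w * T₁) * (N * M) * (suc m * φ * (suc m * φ))) (trans
             (∑-cong (allFin n) λ j → trans
               (total-+ as (λ l → chains (suc m) l B) (λ l → 𝟙 (B j ∧ G (a , j)) * chains m l (B ∖N a)))
               (cong (T₁ +_) (total-*ˡ as (𝟙 (B j ∧ G (a , j))) (λ l → chains m l (B ∖N a)))))
             (trans (∑-+ (allFin n) (λ _ → T₁) (λ j → 𝟙 (B j ∧ G (a , j)) * T₀))
               (cong₂ _+_ (∑-allFin-const n T₁) (∑-*ʳ (allFin n) (λ j → 𝟙 (B j ∧ G (a , j))) T₀)))) ⟩
      (n * T₁ + q * T₀ + w * T₁) * (N * M) * (suc m * φ * (suc m * φ))
        ≡⟨ eq₁ n w T₁ q T₀ M m φ ⟩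
      N * (T₁ * (N * M) * (suc m * φ * (suc m * φ))) + q * N * (suc m * suc m) * (T₀ * M * (φ * φ))
        ≤⟨ +-mono-≤ (*-monoʳ-≤ N (total-chains (suc m) as B))
                    (*-monoʳ-≤ (q * N * (suc m * suc m)) (total-chains m as (B ∖N a))) ⟩
      N * (P * (r ^ suc m * ∣ B ∣ᴮ ^ suc m)) + q * N * (suc m * suc m) * (P * (r ^ m * u ^ m))
        ≡⟨ eq₂ N P (r ^ suc m * ∣ B ∣ᴮ ^ suc m) q m (r ^ m) (u ^ m) ⟩
      N * P * (r ^ suc m * ∣ B ∣ᴮ ^ suc m + suc m * 1 * r ^ m * (suc m * q * u ^ m))
        -- The two factors m + 1 are split: one goes with q u^m and is absorbed by |B| = u + q, the
        -- other stays with r^m and is absorbed below by passing from r to r + 1.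
        ≤⟨ *-monoʳ-≤ (N * P) (+-monoʳ-≤ _ (*-monoʳ-≤ (suc m * 1 * r ^ m) bern)) ⟩
      N * P * (r ^ suc m * ∣ B ∣ᴮ ^ suc m + suc m * 1 * r ^ m * ∣ B ∣ᴮ ^ suc m)
        ≡⟨ cong (N * P *_) (*-distribʳ-+ (∣ B ∣ᴮ ^ suc m) (r ^ suc m) (suc m * 1 * r ^ m)) ⟨
      N * P * ((r ^ suc m + suc m * 1 * r ^ m) * ∣ B ∣ᴮ ^ suc m)
        ≤⟨ *-monoʳ-≤ (N * P) (*-monoˡ-≤ (∣ B ∣ᴮ ^ suc m) (bernoulli m r 1)) ⟩
      N * P * ((r + 1) ^ suc m * ∣ B ∣ᴮ ^ suc m)
        ≡⟨ cong (λ t → N * P * (t ^ suc m * ∣ B ∣ᴮ ^ suc m)) (+-comm r 1) ⟩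
      N * P * (suc r ^ suc m * ∣ B ∣ᴮ ^ suc m) ∎
      where
      open ≤-Reasoning
      N = n + w
      r = length as
      P = N ^ r
      M = N ^ m
      φ = m !
      T₁ = total as (λ l → chains (suc m) l B)
      T₀ = total as (λ l → chains m l (B ∖N a))
      q = ∑ (allFin n) (λ j → 𝟙 (B j ∧ G (a , j)))
      u = ∣ B ∖N a ∣ᴮ
      bern : suc m * q * u ^ m ≤ ∣ B ∣ᴮ ^ suc m
      bern = ≤-trans (m≤n+m _ (u ^ suc m)) (≤-trans (bernoulli m u q)
        (≤-reflexive (cong (_^ suc m) (sym (split-neighbours B a)))))
      eq₁ : ∀ n w T q S M m φ → (n * T + q * S + w * T) * ((n + w) * M) * (suc m * φ * (suc m * φ)) ≡
        (n + w) * (T * ((n + w) * M) * (suc m * φ * (suc m * φ))) + q * (n + w) * (suc m * suc m) * (S * M * (φ * φ))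
      eq₁ = solve-∀
      eq₂ : ∀ N P X q m R U → N * (P * X) + q * N * (suc m * suc m) * (P * (R * U)) ≡
        N * P * (X + suc m * 1 * R * (suc m * q * U))
      eq₂ = solve-∀

    -- The first m edges of S met in the list form a chain. Once (a , j) is taken, inducedness keeps
    -- the right ends of all later edges of S outside N(a), so they survive the shrinking of B;
    -- distinct left ends guarantee that those edges differ from (a , j).
    chains-of-induced : ∀ S → S ⊆ G → IsInducedIn G S → ∀ m l B → DistinctLeft l →
      (∀ e → e ∈ˡ l → e ∈ S → T (B (proj₂ e))) → m ≤ length (filterᵇ S l) → 1 ≤ chains m l B
    chains-of-induced S S⊆G induced zero    l             B dl inB m≤ = s≤s z≤n
    chains-of-induced S S⊆G induced (suc m) ((a , j) ∷ l) B (a≢ ∷ dl) inB m≤ with S (a , j) in eq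
    ... | false = ≤-trans (chains-of-induced S S⊆G induced (suc m) l B dl (λ e → inB e ∘ there) m≤) (m≤m+n _ _)
    ... | true  = ≤-trans
      (*-mono-≤ (one (inB (a , j) (here refl) aj∈S) (S⊆G (a , j) aj∈S))
                (chains-of-induced S S⊆G induced m l (B ∖N a) dl inB′ (≤-pred m≤)))
      (m≤n+m _ (chains (suc m) l B))
      where
      aj∈S : (a , j) ∈ S
      aj∈S = subst T (sym eq) _
      one : ∀ {b g} → T b → T g → 1 ≤ 𝟙 (b ∧ g)
      one {true} {true} _ _ = s≤s z≤n
      not-both : ∀ {b g} → T b → ¬ T g → T (b ∧ not g)
      not-both {true} {false} _ _  = _
      not-both {true} {true}  _ ¬g = ⊥-elim (¬g _)
      inB′ : ∀ e → e ∈ˡ l → e ∈ S → T ((B ∖N a) (proj₂ e))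
      inB′ e e∈l e∈S = not-both (inB e (there e∈l) e∈S) λ a~ →
        induced (a , j) e aj∈S e∈S (λ aj≡e → All.lookup a≢ e∈l (cong proj₁ aj≡e)) (inj₁ a~)

    -- The matching extracted from a pick list.

    keep : List (Edge n) → List (Edge n)
    keep []            = []
    keep ((a , j) ∷ l) = if G (a , j) ∧ (hits j l ≡ᵇ 0) then (a , j) ∷ keep l else keep l

    -- A picked edge of G is dropped only when a later pick has the same right end, so it is charged
    -- to a nonzero `hits` term of `collisions`.
    length-keep : ∀ l → ∑ l (𝟙 ∘ G) ≤ length (keep l) + collisions l
    length-keep []            = z≤n
    length-keep ((a , j) ∷ l) with G (a , j) | hits j l
    ... | false | h     = ≤-trans (length-keep l) (+-monoʳ-≤ (length (keep l)) (m≤n+m _ h))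
    ... | true  | zero  = s≤s (length-keep l)
    ... | true  | suc h = ≤-trans (s≤s (length-keep l))
      (≤-trans (s≤s (+-monoʳ-≤ (length (keep l)) (m≤n+m _ h))) (≤-reflexive (sym (+-suc _ _))))

    keep-⊆ : ∀ l {e} → e ∈ˡ keep l → e ∈ˡ l
    keep-⊆ ((a , j) ∷ l) e∈ with G (a , j) ∧ (hits j l ≡ᵇ 0)
    keep-⊆ ((a , j) ∷ l) e∈         | false = there (keep-⊆ l e∈)
    keep-⊆ ((a , j) ∷ l) (here e≡)  | true  = here e≡
    keep-⊆ ((a , j) ∷ l) (there e∈) | true  = there (keep-⊆ l e∈)

    keep-⊆G : ∀ l {e} → e ∈ˡ keep l → e ∈ G
    keep-⊆G ((a , j) ∷ l) e∈ with G (a , j) in eq | hits j l ≡ᵇ 0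
    keep-⊆G ((a , j) ∷ l) e∈          | false | _     = keep-⊆G l e∈
    keep-⊆G ((a , j) ∷ l) e∈          | true  | false = keep-⊆G l e∈
    keep-⊆G ((a , j) ∷ l) (here refl) | true  | true  = subst T (sym eq) _
    keep-⊆G ((a , j) ∷ l) (there e∈)  | true  | true  = keep-⊆G l e∈

    hits≡0 : ∀ j l → T (hits j l ≡ᵇ 0) → ∀ {e} → e ∈ˡ l → j ≢ proj₂ e
    hits≡0 j (e ∷ l) h e∈ with j ≟ proj₂ e
    hits≡0 j (e ∷ l) h (here refl) | no j≢ = j≢
    hits≡0 j (e ∷ l) h (there e∈)  | no j≢ = hits≡0 j l h e∈

    keep-disjoint : ∀ l → DistinctLeft l → AllPairs (λ e f → ¬ ShareVertex e f) (keep l)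
    keep-disjoint []            []        = []
    keep-disjoint ((a , j) ∷ l) (a≢ ∷ dl) with G (a , j) | hits j l ≡ᵇ 0 in eq
    ... | false | _     = keep-disjoint l dl
    ... | true  | false = keep-disjoint l dl
    ... | true  | true  = All.tabulate disjoint ∷ keep-disjoint l dl
      where
      disjoint : ∀ {f} → f ∈ˡ keep l → ¬ ShareVertex (a , j) f
      disjoint f∈ (inj₁ a≡) = All.lookup a≢ (keep-⊆ l f∈) a≡
      disjoint f∈ (inj₂ j≡) = hits≡0 j l (subst T (sym eq) _) (keep-⊆ l f∈) j≡

    _∈?_ : ∀ (e : Edge n) l → Dec (e ∈ˡ l)
    _∈?_ = DecMembership._∈?_ (≡-dec _≟_ _≟_)

    -- The matching consists of the kept edges. An induced submatching with m edges would occur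
    -- within the pick list and yield a chain, contrary to `no-chain`.
    matching-of-picks : ∀ m l → DistinctLeft l → chains m l (λ _ → true) < 1 →
      ∃[ M ] (M ⊆ G × IsMatching M × ∑ l (𝟙 ∘ G) ≤ size M + collisions l ×
              (∀ M′ → M′ ⊆ M → IsInducedIn G M′ → size M′ < m))
    matching-of-picks m l dl no-chain = M , (λ e e∈M → keep-⊆G l (toWitness e∈M)) , matching
      , ≤-trans (length-keep l) (+-monoˡ-≤ (collisions l) keep≤M) , small
      where
      M : EdgeSet n
      M e = ⌊ e ∈? keep l ⌋
      edges : List (Edge n)
      edges = cartesianProduct (allFin n) (allFin n)
      e∈edges : ∀ e → e ∈ˡ edges
      e∈edges (i , j) = ∈-cartesianProduct⁺ (∈-allFin i) (∈-allFin j)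
      unique-edges : Unique edges
      unique-edges = Unique.cartesianProduct⁺ (Unique.allFin⁺ n) (Unique.allFin⁺ n)
      matching : IsMatching M
      matching e f e∈ f∈ e≢f share
        with ∈-AllPairs₂ (keep-disjoint l dl) (toWitness e∈) (toWitness f∈)
      ... | inj₁ e≡f              = e≢f e≡f
      ... | inj₂ (inj₁ ¬share)    = ¬share share
      ... | inj₂ (inj₂ ¬share)    = ¬share (Sum.map sym sym share)
      keep≤M : length (keep l) ≤ size M
      keep≤M = unique-⊆-length
        (AllPairs.map (λ ¬share e≡f → ¬share (inj₁ (cong proj₁ e≡f))) (keep-disjoint l dl))
        λ {e} e∈ → ∈-filter⁺ (T? ∘ M) (e∈edges e) (fromWitness e∈)
      small : ∀ M′ → M′ ⊆ M → IsInducedIn G M′ → size M′ < m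
      small M′ M′⊆M induced = ≰⇒> λ m≤ → <⇒≱ no-chain
        -- The chain starts from the whole right side, so the condition on right ends holds
        -- trivially.
        (chains-of-induced M′ (λ e e∈ → keep-⊆G l (toWitness (M′⊆M e e∈))) induced m l _ dl _
          (≤-trans m≤ (unique-⊆-length (Unique.filter⁺ (T? ∘ M′) unique-edges) λ {e} e∈ →
            let e∈M′ = proj₂ (∈-filter⁻ (T? ∘ M′) {xs = edges} e∈)
            in ∈-filter⁺ (T? ∘ M′) (keep-⊆ l (toWitness (M′⊆M e e∈M′))) e∈M′)))

-- The first moment argument with its parameters.

-- In 32 = 16 · 2 the factor 16 pays for the loss of 4^m in each of the two factorial bounds. The
-- remaining 2^m is the exponential gain that later beats the constant in K.
[2n]^m≤m!² : ∀ n t → let m = 2 ^ t in 32 * n ≤ m * m → (2 * n) ^ m ≤ m ! * m !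
[2n]^m≤m!² n t 32n≤ = *-cancelˡ-≤ (16 ^ m) {{m^n≢0 16 m}} (begin
  16 ^ m * (2 * n) ^ m             ≡⟨ ^-distribʳ-* 16 (2 * n) m ⟨
  (16 * (2 * n)) ^ m               ≡⟨ cong (_^ m) (*-assoc 16 2 n) ⟨
  (32 * n) ^ m                     ≤⟨ ^-monoˡ-≤ m 32n≤ ⟩
  (m * m) ^ m                      ≡⟨ ^-distribʳ-* m m m ⟩
  m ^ m * m ^ m                    ≤⟨ *-mono-≤ (m^m≤4^m*m! t) (m^m≤4^m*m! t) ⟩
  (4 ^ m * m !) * (4 ^ m * m !)    ≡⟨ eq (4 ^ m) (m !) ⟩
  4 ^ m * 4 ^ m * (m ! * m !)      ≡⟨ cong (_* (m ! * m !)) (^-distribʳ-* 4 4 m) ⟨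
  16 ^ m * (m ! * m !)             ∎)
  where
  open ≤-Reasoning
  m = 2 ^ t
  eq : ∀ a b → (a * b) * (a * b) ≡ a * a * (b * b)
  eq = solve-∀

x+x≤y⇒x<y : ∀ x y → 1 ≤ y → x + x ≤ y → x < y
x+x≤y⇒x<y x y 1≤y x+x≤y = ≰⇒> λ y≤x → <⇒≱ (m<m+n y 1≤y) (≤-trans (+-mono-≤ y≤x y≤x) x+x≤y)

-- Each edge is picked with probability 1/(Kn). An outcome whose number of picked edges of G, scaled
-- by 2K², exceeds `bad` has no chain of length m, and more than n/(2K²) edges remain after the
-- collisions are removed.
matching-without-large-induced : ∀ n .{{_ : NonZero n}} K .{{_ : NonZero K}} t (G : BipartiteGraph n) →
  let m = 2 ^ t in 32 * n ≤ m * m →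
  2 * (n * n) ≤ ∑ (allFin n) (λ i → ∑ (allFin n) (λ j → 𝟙 (G (i , j)))) * K →
  ∃[ M ] (M ⊆ G × IsMatching M × n < 2 * (K * K) * size M ×
          (∀ M′ → M′ ⊆ M → IsInducedIn G M′ → size M′ < m))
matching-without-large-induced n K@(suc K′) t G 32n≤ dense =
  let l , from , lt = total-<-witness (allFin n) {bad} {λ l → 2 * (K * K) * ∑ l (𝟙 ∘ G)} bad<good
      M , M⊆G , matching , E≤ , small =
        matching-of-picks G m l (distinctLeft-picked (Unique.allFin⁺ n) from)
          (≰⇒> λ 1≤X → <⇒≱ lt (begin
            2 * (K * K) * ∑ l (𝟙 ∘ G)             ≤⟨ *-monoʳ-≤ (2 * (K * K)) (E≤n l from) ⟩
            2 * (K * K) * n                       ≤⟨ *-monoʳ-≤ (2 * (K * K)) (m≤m*n n (X l) {{>-nonZero 1≤X}}) ⟩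
            2 * (K * K) * (n * X l)               ≤⟨ m≤n+m _ (2 * (K * K) * collisions l) ⟩
            2 * (K * K) * collisions l + 2 * (K * K) * (n * X l) ≤⟨ m≤m+n _ n ⟩
            bad l                                 ∎))
  in M , M⊆G , matching
     , +-cancelˡ-< (2 * (K * K) * collisions l) _ _ (begin-strict
         2 * (K * K) * collisions l + n             ≤⟨ +-monoˡ-≤ n (m≤m+n _ (2 * (K * K) * (n * X l))) ⟩
         bad l                                      <⟨ lt ⟩
         2 * (K * K) * ∑ l (𝟙 ∘ G)                  ≤⟨ *-monoʳ-≤ (2 * (K * K)) E≤ ⟩
         2 * (K * K) * (size M + collisions l)      ≡⟨ eq₀ (2 * (K * K)) (size M) (collisions l) ⟩
         2 * (K * K) * collisions l + 2 * (K * K) * size M ∎)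
     , small
  where
  -- With this weight for picking nothing, n + w is K n by computation.
  open Picks n (K′ * n)
  open ≤-Reasoning
  m = 2 ^ t
  N = K * n
  P = N ^ n
  as = allFin n
  e = ∑ as (λ i → ∑ (allFin n) (λ j → 𝟙 (G (i , j))))
  X : List (Edge n) → ℕ
  X l = chains G m l (λ _ → true)
  -- The weight 2K²n lets a single chain outweigh every gain, since at most n edges are picked. The
  -- last n is the margin that becomes the lower bound on the matching.
  bad : List (Edge n) → ℕ
  bad l = 2 * (K * K) * collisions l + 2 * (K * K) * (n * X l) + n
  instance
    N≢0 : NonZero N
    N≢0 = m*n≢0 K n
    n²≢0 : NonZero (n * n)
    n²≢0 = m*n≢0 n n
  T_E = total as (λ l → ∑ l (𝟙 ∘ G))
  T_C = total as collisions
  T_X = total as X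
  E≤n : ∀ l → PickedFrom as l → ∑ l (𝟙 ∘ G) ≤ n
  E≤n l from = begin
    ∑ l (𝟙 ∘ G)      ≤⟨ ∑-mono l (λ e → 𝟙≤1 (G e)) ⟩
    ∑ l (λ _ → 1)    ≡⟨ trans (∑-const l 1) (*-identityʳ (length l)) ⟩
    length l         ≤⟨ length-picked from ⟩
    length as        ≡⟨ length-allFin n ⟩
    n                ∎
    where
    𝟙≤1 : ∀ b → 𝟙 b ≤ 1
    𝟙≤1 false = z≤n
    𝟙≤1 true  = s≤s z≤n
  eq₀ : ∀ c s d → c * (s + d) ≡ c * d + c * s
  eq₀ = solve-∀

  edges-bound : 2 * (n * P) ≤ K * K * T_E
  edges-bound = *-cancelʳ-≤ _ _ n (begin
    2 * (n * P) * n      ≡⟨ eq₁ n P ⟩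
    P * (2 * (n * n))    ≤⟨ *-monoʳ-≤ P dense ⟩
    P * (e * K)          ≡⟨ *-assoc P e K ⟨
    P * e * K            ≡⟨ cong (λ r → N ^ r * e * K) (length-allFin n) ⟨
    N ^ length as * e * K ≡⟨ cong (_* K) (total-∑ as G) ⟨
    T_E * N * K          ≡⟨ eq₂ T_E K n ⟩
    K * K * T_E * n      ∎)
    where
    eq₁ : ∀ n P → 2 * (n * P) * n ≡ P * (2 * (n * n))
    eq₁ = solve-∀
    eq₂ : ∀ T K n → T * (K * n) * K ≡ K * K * T * n
    eq₂ = solve-∀

  collisions-bound : K * K * T_C ≤ n * P
  collisions-bound = *-cancelʳ-≤ _ _ (n * n) (begin
    K * K * T_C * (n * n)                        ≡⟨ eq₁ K T_C n ⟩
    T_C * (N * N)                                ≤⟨ total-collisions as ⟩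
    n * (length as * length as) * N ^ length as  ≡⟨ cong (λ r → n * (r * r) * N ^ r) (length-allFin n) ⟩
    n * (n * n) * P                              ≡⟨ eq₂ n P ⟩
    n * P * (n * n)                              ∎)
    where
    eq₁ : ∀ K T n → K * K * T * (n * n) ≡ T * ((K * n) * (K * n))
    eq₁ = solve-∀
    eq₂ : ∀ n P → n * (n * n) * P ≡ n * P * (n * n)
    eq₂ = solve-∀

  2≤m : 2 ≤ m
  2≤m = ≰⇒> λ m≤1 → <⇒≱ {1} {32 * n} (≤-trans (s≤s (s≤s z≤n)) (m≤m*n 32 n))
    (≤-trans 32n≤ (*-mono-≤ m≤1 m≤1))

  chains-bound : 2 * (K * K) * T_X < P
  -- Twice the left side is (2K)² `T_X`. As m ≥ 2, this is at most (2K)^m `T_X`; K^m then turns n^m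
  -- into N^m, and 2^m n^m is bounded by m!².
  chains-bound = x+x≤y⇒x<y _ _ (m^n>0 N n)
    (*-cancelʳ-≤ _ _ (n ^ m * n ^ m) {{m*n≢0 _ _ {{m^n≢0 n m}} {{m^n≢0 n m}}}} (begin
      (2 * (K * K) * T_X + 2 * (K * K) * T_X) * (n ^ m * n ^ m)
        ≡⟨ eq₁ K T_X (n ^ m) ⟩
      T_X * (2 * K) ^ 2 * (n ^ m * n ^ m)
        ≤⟨ *-monoˡ-≤ (n ^ m * n ^ m) (*-monoʳ-≤ T_X (^-monoʳ-≤ (2 * K) 2≤m)) ⟩
      T_X * (2 * K) ^ m * (n ^ m * n ^ m)
        ≡⟨ cong (λ z → T_X * z * (n ^ m * n ^ m)) (^-distribʳ-* 2 K m) ⟩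
      T_X * (2 ^ m * K ^ m) * (n ^ m * n ^ m)
        ≡⟨ eq₂ T_X (2 ^ m) (K ^ m) (n ^ m) ⟩
      T_X * (K ^ m * n ^ m) * (2 ^ m * n ^ m)
        ≡⟨ cong₂ (λ x y → T_X * x * y) (^-distribʳ-* K n m) (^-distribʳ-* 2 n m) ⟨
      T_X * N ^ m * (2 * n) ^ m
        ≤⟨ *-monoʳ-≤ (T_X * N ^ m) ([2n]^m≤m!² n t 32n≤) ⟩
      T_X * N ^ m * (m ! * m !)
        ≤⟨ total-chains G m as (λ _ → true) ⟩
      N ^ length as * (length as ^ m * ∣_∣ᴮ G (λ _ → true) ^ m)
        ≡⟨ cong₂ (λ r s → N ^ r * (r ^ m * s ^ m)) (length-allFin n)
             (trans (∑-allFin-const n 1) (*-identityʳ n)) ⟩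
      P * (n ^ m * n ^ m) ∎))
    where
    eq₁ : ∀ K T z → (2 * (K * K) * T + 2 * (K * K) * T) * (z * z) ≡ T * ((2 * K) * ((2 * K) * 1)) * (z * z)
    eq₁ = solve-∀
    eq₂ : ∀ T a b c → T * (a * b) * (c * c) ≡ T * (b * c) * (a * c)
    eq₂ = solve-∀

  -- In expectation the three terms of `bad` come to at most 2n, less than n, and exactly n, against
  -- at least 4n on the right.
  bad<good : total as bad < total as (λ l → 2 * (K * K) * ∑ l (𝟙 ∘ G))
  bad<good = begin-strict
    total as bad
      ≡⟨ total-+ as (λ l → 2 * (K * K) * collisions l + 2 * (K * K) * (n * X l)) (λ _ → n) ⟩
    total as (λ l → 2 * (K * K) * collisions l + 2 * (K * K) * (n * X l)) + total as (λ _ → n)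
      ≡⟨ cong₂ _+_
           (trans (total-+ as (λ l → 2 * (K * K) * collisions l) (λ l → 2 * (K * K) * (n * X l)))
             (cong₂ _+_ (total-*ˡ as (2 * (K * K)) collisions)
               (trans (total-*ˡ as (2 * (K * K)) (λ l → n * X l)) (cong (2 * (K * K) *_) (total-*ˡ as n X)))))
           (trans (total-const as n) (cong (λ r → N ^ r * n) (length-allFin n))) ⟩
    2 * (K * K) * T_C + 2 * (K * K) * (n * T_X) + P * n
      ≡⟨ eq₁ K T_C n T_X P ⟩
    2 * (K * K * T_C) + n * (2 * (K * K) * T_X) + P * n
      <⟨ +-monoˡ-< (P * n) (+-mono-≤-< (*-monoʳ-≤ 2 collisions-bound) (*-monoʳ-< n chains-bound)) ⟩
    2 * (n * P) + n * P + P * n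
      ≡⟨ eq₂ n P ⟩
    2 * (2 * (n * P))
      ≤⟨ *-monoʳ-≤ 2 edges-bound ⟩
    2 * (K * K * T_E)
      ≡⟨ *-assoc 2 (K * K) T_E ⟨
    2 * (K * K) * T_E
      ≡⟨ total-*ˡ as (2 * (K * K)) (λ l → ∑ l (𝟙 ∘ G)) ⟨
    total as (λ l → 2 * (K * K) * ∑ l (𝟙 ∘ G)) ∎
    where
    eq₁ : ∀ K C n X P → 2 * (K * K) * C + 2 * (K * K) * (n * X) + P * n ≡ 2 * (K * K * C) + n * (2 * (K * K) * X) + P * n
    eq₁ = solve-∀
    eq₂ : ∀ n P → 2 * (n * P) + n * P + P * n ≡ 2 * (2 * (n * P))
    eq₂ = solve-∀

-- The density hypothesis in natural numbers.

edgeCount : ∀ {n} → BipartiteGraph n → ℕ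
edgeCount {n} G = ∑ (allFin n) (λ i → ∑ (allFin n) (λ j → 𝟙 (G (i , j))))

sum-degree : ∀ {n} (G : BipartiteGraph n) → sum (map (degree G) (vertices n)) ≡ 2 * edgeCount G
sum-degree {n} G =
  trans (cong sum (map-++ (degree G) (map inj₁ as) (map inj₂ as)))
  (trans (sum-++ (map (degree G) (map inj₁ as)) (map (degree G) (map inj₂ as)))
  (trans (cong₂ _+_ left right) (cong (edgeCount G +_) (sym (+-identityʳ (edgeCount G))))))
  where
  as = allFin n
  left : sum (map (degree G) (map inj₁ as)) ≡ edgeCount G
  left = trans (cong sum (sym (map-∘ as)))
    (∑-cong as λ i → length-filterᵇ (λ j → G (i , j)) as)
  right : sum (map (degree G) (map inj₂ as)) ≡ edgeCount G
  right = trans (cong sum (sym (map-∘ as)))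
    (trans (∑-cong as λ j → length-filterᵇ (λ i → G (i , j)) as)
           (∑-swap as as (λ j i → 𝟙 (G (i , j)))))

0<fraction : ∀ a d → 0ℚ ℚ.< ℤ.+ suc a ℚ./ suc d
0<fraction a d = ℚ.positive⁻¹ (ℤ.+ suc a ℚ./ suc d) {{ℚ.normalize-pos (suc a) (suc d)}}

unit-fraction-below : ∀ ε → 0ℚ ℚ.< ε → ∃[ d ] mkℚᵘ (ℤ.+ 1) d ℚᵘ.≤ toℚᵘ ε
unit-fraction-below (ℚ.mkℚ (ℤ.+ zero) d _)    (ℚ.*<* (ℤ.+<+ ()))
unit-fraction-below (ℚ.mkℚ (ℤ.-[1+ _ ]) d _)  (ℚ.*<* ())
unit-fraction-below (ℚ.mkℚ (ℤ.+ suc a) d _)   _ =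
  d , ℚᵘ.*≤* (ℤ.+≤+ (*-monoˡ-≤ (suc d) {1} {suc a} (s≤s z≤n)))

mkℚᵘ-mono-≤ : ∀ a b c d → a * suc d ≤ c * suc b → mkℚᵘ (ℤ.+ a) b ℚᵘ.≤ mkℚᵘ (ℤ.+ c) d
mkℚᵘ-mono-≤ a b c d le = ℚᵘ.*≤* (subst₂ ℤ._≤_ (ℤ.pos-* a (suc d)) (ℤ.pos-* c (suc b)) (ℤ.+≤+ le))

mkℚᵘ-cancel-≤ : ∀ a b c d → mkℚᵘ (ℤ.+ a) b ℚᵘ.≤ mkℚᵘ (ℤ.+ c) d → a * suc d ≤ c * suc b
mkℚᵘ-cancel-≤ a b c d (ℚᵘ.*≤* le) =
  ℤ.drop‿+≤+ (subst₂ ℤ._≤_ (sym (ℤ.pos-* a (suc d))) (sym (ℤ.pos-* c (suc b))) le)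

mkℚᵘ-* : ∀ a b c d → mkℚᵘ (ℤ.+ a) b ℚᵘ.* mkℚᵘ (ℤ.+ c) d ≡ mkℚᵘ (ℤ.+ (a * c)) (d + b * suc d)
mkℚᵘ-* a b c d = cong (λ z → mkℚᵘ z (d + b * suc d)) (sym (ℤ.pos-* a c))

mkℚᵘ-+ : ∀ a b c d →
  mkℚᵘ (ℤ.+ a) b ℚᵘ.+ mkℚᵘ (ℤ.+ c) d ≡ mkℚᵘ (ℤ.+ (a * suc d + c * suc b)) (d + b * suc d)
mkℚᵘ-+ a b c d = cong (λ z → mkℚᵘ z (d + b * suc d))
  (sym (cong₂ ℤ._+_ (ℤ.pos-* a (suc d)) (ℤ.pos-* c (suc b))))

toℚᵘ-/ : ∀ a d → toℚᵘ (ℤ.+ a ℚ./ suc d) ℚᵘ.≃ mkℚᵘ (ℤ.+ a) d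
toℚᵘ-/ a d = ℚ.toℚᵘ-fromℚᵘ (mkℚᵘ (ℤ.+ a) d)

-- Carries one rational instance of a real inequality over to natural numbers. With D = d + 1 it
-- amounts to n/D ≤ S/(e + 1) + 1/(2D); the products keep the shape that unnormalised fractions
-- produce.
cross-multiply : ∀ x a S e n d → mkℚᵘ (ℤ.+ 1) d ℚᵘ.≤ toℚᵘ x → toℚᵘ a ℚᵘ.≃ mkℚᵘ (ℤ.+ S) e →
  x ℚ.* (ℤ.+ n ℚ./ 1) ℚ.≤ a ℚ.+ ℤ.+ 1 ℚ./ (2 * suc d) →
  1 * n * (suc e * (2 * suc d)) ≤ (S * (2 * suc d) + 1 * suc e) * (suc d * 1)
cross-multiply x a S e n d d⁻¹≤x a≃ xn≤ = mkℚᵘ-cancel-≤ (1 * n) (0 + d * 1) (S * suc f + 1 * suc e) (f + e * suc f)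
  (subst₂ ℚᵘ._≤_ (mkℚᵘ-* 1 d n 0) (mkℚᵘ-+ S e 1 f) (begin
    mkℚᵘ (ℤ.+ 1) d ℚᵘ.* mkℚᵘ (ℤ.+ n) 0     ≤⟨ ℚᵘ.*-monoˡ-≤-nonNeg (mkℚᵘ (ℤ.+ n) 0) d⁻¹≤x ⟩
    toℚᵘ x ℚᵘ.* mkℚᵘ (ℤ.+ n) 0             ≃⟨ ℚᵘ.*-congˡ {toℚᵘ x} (toℚᵘ-/ n 0) ⟨
    toℚᵘ x ℚᵘ.* toℚᵘ (ℤ.+ n ℚ./ 1)         ≃⟨ ℚ.toℚᵘ-homo-* x (ℤ.+ n ℚ./ 1) ⟨
    toℚᵘ (x ℚ.* (ℤ.+ n ℚ./ 1))             ≤⟨ ℚ.toℚᵘ-mono-≤ xn≤ ⟩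
    toℚᵘ (a ℚ.+ ℤ.+ 1 ℚ./ suc f)           ≃⟨ ℚ.toℚᵘ-homo-+ a (ℤ.+ 1 ℚ./ suc f) ⟩
    toℚᵘ a ℚᵘ.+ toℚᵘ (ℤ.+ 1 ℚ./ suc f)     ≃⟨ ℚᵘ.+-cong a≃ (toℚᵘ-/ 1 f) ⟩
    mkℚᵘ (ℤ.+ S) e ℚᵘ.+ mkℚᵘ (ℤ.+ 1) f     ∎))
  where
  open ℚᵘ.≤-Reasoning
  f = d + 1 * suc d

-- The terms of c are eventually at least some 1/D, and the average degree is e/n for e edges. Hence
-- n/D ≤ e/n + 1/(2D), and 1/(2D) ≤ n/(2D) leaves 2n² ≤ 4De.
edgeCount-≥ : ∀ c → 0ℝ <ℝ c → ∃[ k ] (∀ n (G : BipartiteGraph (suc n)) →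
  c *ℝ fromℕ (suc n) ≤ℝ fromℚ (averageDegree G) → 2 * (suc n * suc n) ≤ edgeCount G * suc k)
edgeCount-≥ c (ε , 0<ε , N , ε≤c) with unit-fraction-below ε 0<ε
-- The successor of this witness is 4D.
... | d , d⁻¹≤ε = 3 + 4 * d , bound
  where
  D = suc d
  clear-denominators : ∀ n e → 1 * n * ((2 * n) * (2 * D)) ≤ (2 * e * (2 * D) + 1 * (2 * n)) * (D * 1) →
    .{{_ : NonZero n}} → 2 * (n * n) ≤ e * (4 + 4 * d)
  clear-denominators n e le = begin
    2 * (n * n)         ≤⟨ *-monoʳ-≤ 2 (+-cancelʳ-≤ (n * n) (n * n) (2 * e * D) (*-cancelʳ-≤ _ _ (2 * D) n²+n²≤)) ⟩
    2 * (2 * e * D)     ≡⟨ eq₃ e d ⟩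
    e * (4 + 4 * d)     ∎
    where
    open ≤-Reasoning
    eq₁ : ∀ a b → (a * a + a * a) * (2 * b) ≡ 1 * a * ((2 * a) * (2 * b))
    eq₁ = solve-∀
    eq₂ : ∀ e D a → (2 * e * (2 * D) + 1 * (2 * a)) * (D * 1) ≡ (2 * e * D + a) * (2 * D)
    eq₂ = solve-∀
    eq₃ : ∀ e d → 2 * (2 * e * suc d) ≡ e * (4 + 4 * d)
    eq₃ = solve-∀
    n²+n²≤ : (n * n + n * n) * (2 * D) ≤ (2 * e * D + n * n) * (2 * D)
    n²+n²≤ = begin
      (n * n + n * n) * (2 * D)                 ≡⟨ eq₁ n D ⟩
      1 * n * ((2 * n) * (2 * D))               ≤⟨ le ⟩
      (2 * e * (2 * D) + 1 * (2 * n)) * (D * 1) ≡⟨ eq₂ e D n ⟩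
      (2 * e * D + n) * (2 * D)                 ≤⟨ *-monoˡ-≤ (2 * D) (+-monoʳ-≤ (2 * e * D) (m≤m*n n n)) ⟩
      (2 * e * D + n * n) * (2 * D)             ∎
  bound : ∀ n (G : BipartiteGraph (suc n)) →
    c *ℝ fromℕ (suc n) ≤ℝ fromℚ (averageDegree G) →
    2 * (suc n * suc n) ≤ edgeCount G * (4 + 4 * d)
  bound n G dense =
    let N′ , dense′ = dense (ℤ.+ 1 ℚ./ (2 * suc d)) (0<fraction 0 (d + 1 * suc d))
        k = N ⊔ N′
    in clear-denominators (suc n) (edgeCount G)
         (cross-multiply (seq c k) (averageDegree G) (2 * edgeCount G) (n + 1 * suc n) (suc n) d
           (ℚᵘ.≤-trans d⁻¹≤ε (ℚ.toℚᵘ-mono-≤ (subst (ℚ._≤ seq c k) (ℚ.+-identityˡ ε) (ε≤c k (m≤m⊔n N N′)))))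
           (subst (λ S → toℚᵘ (averageDegree G) ℚᵘ.≃ mkℚᵘ (ℤ.+ S) (n + 1 * suc n)) (sum-degree G)
             (toℚᵘ-/ (sum (map (degree G) (vertices (suc n)))) (n + 1 * suc n)))
           (dense′ k (m≤n⊔m N N′)))

-- Comparison with the inverse square root, and conclusion.

-- The constant comes from (3K²m)² · 4p²n < 36 · 128 · (K²pn)² ≤ (68K²pn)².
rsqrt-bound : ∀ n .{{_ : NonZero n}} K .{{_ : NonZero K}} m .{{_ : NonZero m}} J p →
  m * m < 4 * (32 * n) → J * J < suc p * suc p * n → n ≤ J →
  (2 * (K * K) * m + 1) * J ≤ 68 * (K * K) * p * n
rsqrt-bound n K m J zero m² J² n≤J = ⊥-elim (<⇒≱ J² (begin
  1 * n    ≡⟨ *-identityˡ n ⟩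
  n        ≤⟨ m≤m*n n n ⟩
  n * n    ≤⟨ *-mono-≤ n≤J n≤J ⟩
  J * J    ∎))
  where open ≤-Reasoning
rsqrt-bound n K m J p@(suc p′) m² J² n≤J = ≮⇒≥ λ lt → <-irrefl refl (begin-strict
  (68 * (K * K) * p * n) * (68 * (K * K) * p * n)
    <⟨ *-mono-< lt lt ⟩
  (L * J) * (L * J)
    ≡⟨ eq₁ L J ⟩
  L * L * (J * J)
    ≤⟨ *-mono-≤ (*-mono-≤ L≤ L≤) (<⇒≤ J²) ⟩
  (3 * (K * K * m)) * (3 * (K * K * m)) * (suc p * suc p * n)
    ≤⟨ *-monoʳ-≤ ((3 * (K * K * m)) * (3 * (K * K * m))) (*-monoˡ-≤ n (*-mono-≤ p≤ p≤)) ⟩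
  (3 * (K * K * m)) * (3 * (K * K * m)) * ((2 * p) * (2 * p) * n)
    ≡⟨ eq₂ K m p n ⟩
  36 * (K * K * K * K * p * p * n) * (m * m)
    ≤⟨ *-monoʳ-≤ (36 * (K * K * K * K * p * p * n)) (<⇒≤ m²) ⟩
  36 * (K * K * K * K * p * p * n) * (4 * (32 * n))
    ≤⟨ m≤m+n _ (16 * (K * K * K * K * p * p * n * n)) ⟩
  36 * (K * K * K * K * p * p * n) * (4 * (32 * n)) + 16 * (K * K * K * K * p * p * n * n)
    ≡⟨ eq₃ K p n ⟩
  (68 * (K * K) * p * n) * (68 * (K * K) * p * n) ∎)
  where
  open ≤-Reasoning
  L = 2 * (K * K) * m + 1
  L≤ : L ≤ 3 * (K * K * m)
  L≤ = begin
    2 * (K * K) * m + 1            ≤⟨ +-monoʳ-≤ (2 * (K * K) * m) (>-nonZero⁻¹ (K * K * m) {{m*n≢0 (K * K) m {{m*n≢0 K K}}}}) ⟩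
    2 * (K * K) * m + K * K * m    ≡⟨ eq K m ⟩
    3 * (K * K * m)                ∎
    where
    eq : ∀ K m → 2 * (K * K) * m + K * K * m ≡ 3 * (K * K * m)
    eq = solve-∀
  p≤ : suc p ≤ 2 * p
  p≤ = ≤-trans (m<m+n p (s≤s z≤n)) (≤-reflexive (cong (p +_) (sym (+-identityʳ p))))
  eq₁ : ∀ L J → (L * J) * (L * J) ≡ L * L * (J * J)
  eq₁ = solve-∀
  eq₂ : ∀ K m p n → (3 * (K * K * m)) * (3 * (K * K * m)) * ((2 * p) * (2 * p) * n) ≡ 36 * (K * K * K * K * p * p * n) * (m * m)
  eq₂ = solve-∀
  eq₃ : ∀ K p n → 36 * (K * K * K * K * p * p * n) * (4 * (32 * n)) + 16 * (K * K * K * K * p * p * n * n)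
      ≡ (68 * (K * K) * p * n) * (68 * (K * K) * p * n)
  eq₃ = solve-∀

-- After multiplication by s + 1, the left side is at most s′ + 1 + (s + 1)/(n + 1), and `le`
-- compares this with the right side after clearing denominators.
divide-≤ : ∀ x n s s′ C p k →
  (suc s′ * suc n + suc s) * suc k ≤ suc s * (C * p * suc n) →
  x ℚ.* (ℤ.+ suc s ℚ./ 1) ℚ.≤ ℤ.+ s′ ℚ./ 1 ℚ.+ 1ℚ →
  x ℚ.+ ℤ.+ 1 ℚ./ suc n ℚ.≤ (ℤ.+ C ℚ./ 1) ℚ.* (ℤ.+ p ℚ./ suc k)
divide-≤ x n s s′ C p k le xs≤ = ℚ.toℚᵘ-cancel-≤ (ℚᵘ.*-cancelʳ-≤-pos σ (begin
  toℚᵘ (x ℚ.+ ℤ.+ 1 ℚ./ suc n) ℚᵘ.* σ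
    ≃⟨ ℚᵘ.*-congʳ {σ} (ℚᵘ.≃-trans (ℚ.toℚᵘ-homo-+ x (ℤ.+ 1 ℚ./ suc n))
         (ℚᵘ.+-congʳ (toℚᵘ x) (toℚᵘ-/ 1 n))) ⟩
  (toℚᵘ x ℚᵘ.+ mkℚᵘ (ℤ.+ 1) n) ℚᵘ.* σ
    ≃⟨ ℚᵘ.*-distribʳ-+ σ (toℚᵘ x) (mkℚᵘ (ℤ.+ 1) n) ⟩
  toℚᵘ x ℚᵘ.* σ ℚᵘ.+ mkℚᵘ (ℤ.+ 1) n ℚᵘ.* σ
    ≤⟨ ℚᵘ.+-monoˡ-≤ (mkℚᵘ (ℤ.+ 1) n ℚᵘ.* σ) xσ≤ ⟩
  (mkℚᵘ (ℤ.+ s′) 0 ℚᵘ.+ mkℚᵘ (ℤ.+ 1) 0) ℚᵘ.+ mkℚᵘ (ℤ.+ 1) n ℚᵘ.* σ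
    ≡⟨ cong₂ ℚᵘ._+_ (mkℚᵘ-+ s′ 0 1 0) (mkℚᵘ-* 1 n (suc s) 0) ⟩
  mkℚᵘ (ℤ.+ (s′ * 1 + 1 * 1)) 0 ℚᵘ.+ mkℚᵘ (ℤ.+ (1 * suc s)) (n * 1)
    ≡⟨ mkℚᵘ-+ (s′ * 1 + 1 * 1) 0 (1 * suc s) (n * 1) ⟩
  mkℚᵘ (ℤ.+ ((s′ * 1 + 1 * 1) * suc (n * 1) + 1 * suc s * 1)) (n * 1 + 0)
    ≤⟨ mkℚᵘ-mono-≤ ((s′ * 1 + 1 * 1) * suc (n * 1) + 1 * suc s * 1) (n * 1 + 0)
         (C * p * suc s) ((k + 0) * 1) cross ⟩
  mkℚᵘ (ℤ.+ (C * p * suc s)) ((k + 0) * 1)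
    ≡⟨ mkℚᵘ-* (C * p) (k + 0) (suc s) 0 ⟨
  mkℚᵘ (ℤ.+ (C * p)) (k + 0) ℚᵘ.* σ
    ≡⟨ cong (ℚᵘ._* σ) (mkℚᵘ-* C 0 p k) ⟨
  mkℚᵘ (ℤ.+ C) 0 ℚᵘ.* mkℚᵘ (ℤ.+ p) k ℚᵘ.* σ
    ≃⟨ ℚᵘ.*-congʳ {σ} (ℚᵘ.≃-sym (ℚᵘ.≃-trans (ℚ.toℚᵘ-homo-* (ℤ.+ C ℚ./ 1) (ℤ.+ p ℚ./ suc k))
         (ℚᵘ.*-cong (toℚᵘ-/ C 0) (toℚᵘ-/ p k)))) ⟩
  toℚᵘ ((ℤ.+ C ℚ./ 1) ℚ.* (ℤ.+ p ℚ./ suc k)) ℚᵘ.* σ ∎))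
  where
  open ℚᵘ.≤-Reasoning
  σ = mkℚᵘ (ℤ.+ suc s) 0
  xσ≤ : toℚᵘ x ℚᵘ.* σ ℚᵘ.≤ mkℚᵘ (ℤ.+ s′) 0 ℚᵘ.+ mkℚᵘ (ℤ.+ 1) 0
  xσ≤ = begin
    toℚᵘ x ℚᵘ.* σ                              ≃⟨ ℚᵘ.*-congˡ {toℚᵘ x} (toℚᵘ-/ (suc s) 0) ⟨
    toℚᵘ x ℚᵘ.* toℚᵘ (ℤ.+ suc s ℚ./ 1)         ≃⟨ ℚ.toℚᵘ-homo-* x (ℤ.+ suc s ℚ./ 1) ⟨
    toℚᵘ (x ℚ.* (ℤ.+ suc s ℚ./ 1))             ≤⟨ ℚ.toℚᵘ-mono-≤ xs≤ ⟩
    toℚᵘ (ℤ.+ s′ ℚ./ 1 ℚ.+ 1ℚ)                 ≃⟨ ℚ.toℚᵘ-homo-+ (ℤ.+ s′ ℚ./ 1) 1ℚ ⟩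
    toℚᵘ (ℤ.+ s′ ℚ./ 1) ℚᵘ.+ mkℚᵘ (ℤ.+ 1) 0    ≃⟨ ℚᵘ.+-congˡ (mkℚᵘ (ℤ.+ 1) 0) (toℚᵘ-/ s′ 0) ⟩
    mkℚᵘ (ℤ.+ s′) 0 ℚᵘ.+ mkℚᵘ (ℤ.+ 1) 0        ∎
  cross : ((s′ * 1 + 1 * 1) * suc (n * 1) + 1 * suc s * 1) * suc ((k + 0) * 1) ≤
          C * p * suc s * suc (n * 1 + 0)
  cross = subst₂ _≤_ (eq₁ n s s′ k) (eq₂ n s C p) le
    where
    eq₁ : ∀ n s s′ k → (suc s′ * suc n + suc s) * suc k ≡
          ((s′ * 1 + 1 * 1) * suc (n * 1) + 1 * suc s * 1) * suc ((k + 0) * 1)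
    eq₁ = solve-∀
    eq₂ : ∀ n s C p → suc s * (C * p * suc n) ≡ C * p * suc s * suc (n * 1 + 0)
    eq₂ = solve-∀

-- The hypotheses put α at about A/(n + 1) at most. The extra 1 in A + 1 provides the gap 1/(n + 1)
-- that strict inequality of reals demands.
ratio-<-rsqrt : ∀ n s s′ A C (α : ℝ) →
  (∀ J p → J * J < suc p * suc p * suc n → suc n ≤ J → (A + 1) * J ≤ C * p * suc n) →
  suc s′ * suc n ≤ A * suc s →
  α *ℝ fromℕ (suc s) ≤ℝ fromℕ s′ → α <ℝ fromℕ C *ℝ (suc n ^-½)
ratio-<-rsqrt n s s′ A C α rsqrt≥ s′n≤ αs≤ =
  -- An error of 1 is affordable because the bound on sizes is assumed for s′ + 1. Starting at index
  -- n + 1 makes the denominator J at least n + 1, which forces its numerator p to be positive.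
  let N , αs≤′ = αs≤ 1ℚ (ℚ.positive⁻¹ 1ℚ)
  in ℤ.+ 1 ℚ./ suc n , 0<fraction 0 n , N ⊔ suc n , λ k N≤k →
    let p , _ , k< = floorRSqrt (suc n) (suc k)
    in divide-≤ (seq α k) n s s′ C p k
         (natural k p (rsqrt≥ (suc k) p k< (m≤n⇒m≤1+n (m⊔n≤o⇒n≤o N (suc n) N≤k))))
         (αs≤′ k (m⊔n≤o⇒m≤o N (suc n) N≤k))
  where
  natural : ∀ k p → (A + 1) * suc k ≤ C * p * suc n →
    (suc s′ * suc n + suc s) * suc k ≤ suc s * (C * p * suc n)
  natural k p le = begin
    (suc s′ * suc n + suc s) * suc k   ≤⟨ *-monoˡ-≤ (suc k) (+-monoˡ-≤ (suc s) s′n≤) ⟩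
    (A * suc s + suc s) * suc k        ≡⟨ eq A (suc s) (suc k) ⟩
    suc s * ((A + 1) * suc k)          ≤⟨ *-monoʳ-≤ (suc s) le ⟩
    suc s * (C * p * suc n)            ∎
    where
    open ≤-Reasoning
    eq : ∀ A s k → (A * s + s) * k ≡ s * ((A + 1) * k)
    eq = solve-∀

-- The matching has more than n/(2K²) edges and its induced part fewer than m, so α is below about
-- 2K²m/n, where m² < 128n makes m of order √n; here n stands for the size of a side.
multitasker-bound : ∀ n K .{{_ : NonZero K}} (G : BipartiteGraph (suc n)) (α : ℝ) →
  2 * (suc n * suc n) ≤ edgeCount G * K → IsMultitasker α G →
  α <ℝ fromℕ (68 * (K * K)) *ℝ (suc n ^-½)
multitasker-bound n K G α dense multitasker =
  let t , 32n≤ , <128n = square-between (32 * suc n) (s≤s z≤n)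
      M , M⊆G , matching , n< , small = matching-without-large-induced (suc n) K t G 32n≤ dense
      -- The multitasker property speaks of nonempty matchings only; the lower bound on `size M`
      -- supplies this.
      1≤M = n≢0⇒n>0 λ M≡0 → n≮0 (subst (suc n <_)
        (trans (cong (2 * (K * K) *_) M≡0) (*-zeroʳ (2 * (K * K)))) n<)
      M′ , M′⊆M , _ , induced , αM≤ = multitasker M M⊆G matching 1≤M
  in conclude t <128n (size M) (size M′) 1≤M n< (small M′ M′⊆M induced) αM≤
  where
  conclude : ∀ t → 2 ^ t * 2 ^ t < 4 * (32 * suc n) → ∀ s s′ → 1 ≤ s →
    suc n < 2 * (K * K) * s → s′ < 2 ^ t →
    α *ℝ fromℕ s ≤ℝ fromℕ s′ → α <ℝ fromℕ (68 * (K * K)) *ℝ (suc n ^-½)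
  conclude t <128n (suc s) s′ _ n< s′< = ratio-<-rsqrt n s s′ (2 * (K * K) * m) (68 * (K * K)) α
    (λ J p → rsqrt-bound (suc n) K m {{m^n≢0 2 t}} J p <128n)
    (begin
      suc s′ * suc n             ≤⟨ *-mono-≤ s′< (<⇒≤ n<) ⟩
      m * (2 * (K * K) * suc s)  ≡⟨ eq m (2 * (K * K)) (suc s) ⟩
      2 * (K * K) * m * suc s    ∎)
    where
    open ≤-Reasoning
    m = 2 ^ t
    eq : ∀ m c s → m * (c * s) ≡ c * m * s
    eq = solve-∀

0<fromℕ : ∀ C → 0 < C → 0ℝ <ℝ fromℕ C
0<fromℕ (suc C) _ = ℤ.+ suc C ℚ./ 1 , 0<fraction C 0 , 0 , λ _ _ → ℚ.≤-reflexive (ℚ.+-identityˡ (ℤ.+ suc C ℚ./ 1))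

theorem3p15 : ∀ (c : ℝ) → 0ℝ <ℝ c →
    ∃[ C ] (0ℝ <ℝ C ×
    (∀ (n : ℕ) .{{_ : NonZero n}} (G : BipartiteGraph n) →
    c *ℝ fromℕ n ≤ℝ fromℚ (averageDegree G) →
    ∀ (α : ℝ) → 0ℝ <ℝ α → α ≤ℝ 1ℝ →
    IsMultitasker α G →
    α <ℝ C *ℝ (n ^-½)))
theorem3p15 c 0<c =
  let k , edges = edgeCount-≥ c 0<c
  in fromℕ (68 * (suc k * suc k)) , 0<fromℕ (68 * (suc k * suc k)) (s≤s z≤n) , λ where
       (suc n) G dense α _ _ multitasker →
         multitasker-bound n (suc k) G α (edges n G dense) multitasker
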